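{- Let $\alpha,\beta$ be integers with $\beta \geq \alpha + 1$, $\alpha \geq 3$ and $\beta \geq 5$. Then the groups \[ \Gamma^{2^{\alpha}, 2^{\beta}}(3,\ 1+2^{\beta-2},\ -3,\ -1+2^{\beta-2}) \quad\text{and}\quad \Gamma^{2^{\alpha}, 2^{\beta}}(3,\ 1-2^{\beta-2},\ -3,\ -1-2^{\beta-2}) \] are the automorphism groups of tight chiral polyhedra of type $\{2^{\alpha}, 2^{\beta}\}$.
   Context: For integers $p,q,i_1,j_1,i_2,j_2$, $\Gamma^{p,q}(i_1,j_1,i_2,j_2)$ denotes the group with presentation $\langle \sigma_1,\sigma_2 \mid \sigma_1^p=\sigma_2^q=(\sigma_1\sigma_2)^2=1,\ \sigma_2^{ -1}\sigma_1=\sigma_1^{i_1}\sigma_2^{j_1},\ \sigma_2\sigma_1^{ -1}=\sigma_1^{i_2}\sigma_2^{j_2}\rangle$. An (abstract) polyhedron is a partially ordered set whose elements have rank $0$, $1$, $2$ (vertices, edges, faces), incidence meaning comparability, such that every edge is incident to exactly two vertices and two faces, whenever a vertex is incident to a face exactly two edges are incident to both, the incidence graph is connected, and for each vertex or face the subgraph of the incidence graph induced on its neighbours is connected. A flag is a mutually incident (vertex, edge, face) triple; $\Phi^i$ is the flag differing from $\Phi$ exactly in its rank-$i$ element. Type $\{p,q\}$: faces are incident to $p$ edges and vertices to $q$ edges. The polyhedron is chiral if its flags split into two classes with $\Phi,\Phi^i$ always in different classes and the automorphism group transitive on each class but not on all flags; then, fixing a base flag $\Phi$, the automorphism group is generated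 by $\sigma_1:\Phi\mapsto(\Phi^1)^0$ and $\sigma_2:\Phi\mapsto(\Phi^2)^1$. A group $\langle\sigma_1,\sigma_2\rangle$ "is the automorphism group of" such a polyhedron if there is an isomorphism onto it sending the generators $\sigma_1,\sigma_2$ to these distinguished generators. A polyhedron of type $\{p,q\}$ is tight if it has exactly $2pq$ flags. -}

module Defs where

open import Data.Nat using (ℕ; zero; suc; _+_; _*_)
open import Data.Integer using (ℤ; +_; -[1+_])
open import Data.Fin using (Fin; zero; suc)
open import Data.Bool using (Bool; true; false; _∧_; if_then_else_)
open import Data.Product using (Σ; ∃; _×_; _,_; proj₁; proj₂)
open import Data.Sum using (_⊎_; inj₁; inj₂)
open import Data.Unit using (⊤)
open import Data.Empty using (⊥)
open import Relation.Nullary using (¬_)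
open import Relation.Binary.PropositionalEquality using (_≡_; _≢_; refl; trans; sym; cong)

count : (n : ℕ) → (Fin n → Bool) → ℕ
count zero    b = 0
count (suc n) b = (if b zero then 1 else 0) + count n (λ i → b (suc i))

sumFin : (n : ℕ) → (Fin n → ℕ) → ℕ
sumFin zero    g = 0
sumFin (suc n) g = g zero + sumFin n (λ i → g (suc i))

-- Finitely presented group Γ^{p,q}(i₁,j₁,i₂,j₂): words modulo the
-- congruence generated by the group axioms and the defining relations.

data Word : Set where
  σ₁ σ₂ ε : Word
  _·_     : Word → Word → Word
  inv     : Word → Word

infixl 7 _·_

powℕ : Word → ℕ → Word
powℕ w zero    = ε
powℕ w (suc n) = w · powℕ w n

powℤ : Word → ℤ → Word
powℤ w (+ n)    = powℕ w n
powℤ w -[1+ n ] = powℕ (inv w) (suc n)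

data ΓRel (p q : ℕ) (i₁ j₁ i₂ j₂ : ℤ) : Word → Word → Set where
  rfl   : ∀ {w} → ΓRel p q i₁ j₁ i₂ j₂ w w
  sy    : ∀ {w u} → ΓRel p q i₁ j₁ i₂ j₂ w u → ΓRel p q i₁ j₁ i₂ j₂ u w
  tr    : ∀ {w u t} → ΓRel p q i₁ j₁ i₂ j₂ w u → ΓRel p q i₁ j₁ i₂ j₂ u t → ΓRel p q i₁ j₁ i₂ j₂ w t
  ·-cong : ∀ {w w′ u u′} → ΓRel p q i₁ j₁ i₂ j₂ w w′ → ΓRel p q i₁ j₁ i₂ j₂ u u′ →
           ΓRel p q i₁ j₁ i₂ j₂ (w · u) (w′ · u′)
  inv-cong : ∀ {w w′} → ΓRel p q i₁ j₁ i₂ j₂ w w′ → ΓRel p q i₁ j₁ i₂ j₂ (inv w) (inv w′)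
  assoc : ∀ {w u t} → ΓRel p q i₁ j₁ i₂ j₂ ((w · u) · t) (w · (u · t))
  idˡ   : ∀ {w} → ΓRel p q i₁ j₁ i₂ j₂ (ε · w) w
  idʳ   : ∀ {w} → ΓRel p q i₁ j₁ i₂ j₂ (w · ε) w
  invˡ  : ∀ {w} → ΓRel p q i₁ j₁ i₂ j₂ (inv w · w) ε
  invʳ  : ∀ {w} → ΓRel p q i₁ j₁ i₂ j₂ (w · inv w) ε
  rel₁  : ΓRel p q i₁ j₁ i₂ j₂ (powℕ σ₁ p) ε
  rel₂  : ΓRel p q i₁ j₁ i₂ j₂ (powℕ σ₂ q) ε
  rel₃  : ΓRel p q i₁ j₁ i₂ j₂ (powℕ (σ₁ · σ₂) 2) ε
  rel₄  : ΓRel p q i₁ j₁ i₂ j₂ (inv σ₂ · σ₁) (powℤ σ₁ i₁ · powℤ σ₂ j₁)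
  rel₅  : ΓRel p q i₁ j₁ i₂ j₂ (σ₂ · inv σ₁) (powℤ σ₁ i₂ · powℤ σ₂ j₂)

-- Finite ranked posets of rank ≤ 2 (vertices, edges, faces).
-- The order is given by the (Boolean) incidences vertex<edge, edge<face,
-- vertex<face; elements of equal rank are incomparable.

record Incidence : Set where
  field
    nV nE nF : ℕ
    VE : Fin nV → Fin nE → Bool
    EF : Fin nE → Fin nF → Bool
    VF : Fin nV → Fin nF → Bool
    trans-VEF : ∀ v e f → VE v e ≡ true → EF e f ≡ true → VF v f ≡ true

module _ (P : Incidence) where
  open Incidence P

  Elt : Set
  Elt = Fin nV ⊎ (Fin nE ⊎ Fin nF)

  Inc : Elt → Elt → Set
  Inc (inj₁ v)        (inj₂ (inj₁ e)) = VE v e ≡ true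
  Inc (inj₁ v)        (inj₂ (inj₂ f)) = VF v f ≡ true
  Inc (inj₂ (inj₁ e)) (inj₁ v)        = VE v e ≡ true
  Inc (inj₂ (inj₁ e)) (inj₂ (inj₂ f)) = EF e f ≡ true
  Inc (inj₂ (inj₂ f)) (inj₁ v)        = VF v f ≡ true
  Inc (inj₂ (inj₂ f)) (inj₂ (inj₁ e)) = EF e f ≡ true
  Inc _               _               = ⊥

  data Path (S : Elt → Set) : Elt → Elt → Set where
    here : ∀ {x} → S x → Path S x x
    step : ∀ {x y z} → Path S x y → Inc y z → S z → Path S x z

  ConnectedOn : (Elt → Set) → Set
  ConnectedOn S = ∀ x y → S x → S y → Path S x y

  record IsPolyhedron : Set where
    field
      edge-two-vertices : ∀ e → count nV (λ v → VE v e) ≡ 2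
      edge-two-faces    : ∀ e → count nF (λ f → EF e f) ≡ 2
      diamond           : ∀ v f → VF v f ≡ true → count nE (λ e → VE v e ∧ EF e f) ≡ 2
      connected         : ConnectedOn (λ _ → ⊤)
      vertex-connected  : ∀ v → ConnectedOn (Inc (inj₁ v))
      face-connected    : ∀ f → ConnectedOn (Inc (inj₂ (inj₂ f)))

  HasType : ℕ → ℕ → Set
  HasType p q = (∀ f → count nE (λ e → EF e f) ≡ p)
              × (∀ v → count nE (λ e → VE v e) ≡ q)

  record Flag : Set where
    constructor flag
    field
      fv : Fin nV
      fe : Fin nE
      ff : Fin nF
      ve : VE fv fe ≡ true
      ef : EF fe ff ≡ true
      vf : VF fv ff ≡ true
  open Flag public

  numFlags : ℕ
  numFlags = sumFin nV (λ v → sumFin nE (λ e → sumFin nF (λ f →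
               if VE v e ∧ EF e f ∧ VF v f then 1 else 0)))

  Tight : ℕ → ℕ → Set
  Tight p q = numFlags ≡ 2 * p * q

  SameFlag : Flag → Flag → Set
  SameFlag Φ Ψ = fv Φ ≡ fv Ψ × fe Φ ≡ fe Ψ × ff Φ ≡ ff Ψ

  Adj : Fin 3 → Flag → Flag → Set
  Adj zero             Φ Ψ = fv Φ ≢ fv Ψ × fe Φ ≡ fe Ψ × ff Φ ≡ ff Ψ
  Adj (suc zero)       Φ Ψ = fv Φ ≡ fv Ψ × fe Φ ≢ fe Ψ × ff Φ ≡ ff Ψ
  Adj (suc (suc zero)) Φ Ψ = fv Φ ≡ fv Ψ × fe Φ ≡ fe Ψ × ff Φ ≢ ff Ψ

  record Perm (n : ℕ) : Set where
    field
      to   : Fin n → Fin n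
      from : Fin n → Fin n
      to-from : ∀ x → to (from x) ≡ x
      from-to : ∀ x → from (to x) ≡ x
  open Perm public

  record Aut : Set where
    field
      πV : Perm nV
      πE : Perm nE
      πF : Perm nF
      presVE : ∀ v e → VE (to πV v) (to πE e) ≡ VE v e
      presEF : ∀ e f → EF (to πE e) (to πF f) ≡ EF e f
      presVF : ∀ v f → VF (to πV v) (to πF f) ≡ VF v f
  open Aut public

  AutEq : Aut → Aut → Set
  AutEq α β = (∀ v → to (πV α) v ≡ to (πV β) v)
            × (∀ e → to (πE α) e ≡ to (πE β) e)
            × (∀ f → to (πF α) f ≡ to (πF β) f)

  act : Aut → Flag → Flag
  act α (flag v e f ve ef vf) =
    flag (to (πV α) v) (to (πE α) e) (to (πF α) f)
         (trans (presVE α v e) ve) (trans (presEF α e f) ef) (trans (presVF α v f) vf)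

  permId : ∀ {n} → Perm n
  permId = record { to = λ x → x ; from = λ x → x ; to-from = λ _ → refl ; from-to = λ _ → refl }

  permComp : ∀ {n} → Perm n → Perm n → Perm n
  permComp a b = record
    { to = λ x → to a (to b x) ; from = λ x → from b (from a x)
    ; to-from = λ x → trans (cong (to a) (to-from b (from a x))) (to-from a x)
    ; from-to = λ x → trans (cong (from b) (from-to a (to b x))) (from-to b x) }

  permInv : ∀ {n} → Perm n → Perm n
  permInv a = record { to = from a ; from = to a ; to-from = from-to a ; from-to = to-from a }

  autId : Aut
  autId = record { πV = permId ; πE = permId ; πF = permId
                 ; presVE = λ _ _ → refl ; presEF = λ _ _ → refl ; presVF = λ _ _ → refl }

  autComp : Aut → Aut → Aut
  autComp α β = record
    { πV = permComp (πV α) (πV β) ; πE = permComp (πE α) (πE β) ; πF = permComp (πF α) (πF β)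
    ; presVE = λ v e → trans (presVE α _ _) (presVE β v e)
    ; presEF = λ e f → trans (presEF α _ _) (presEF β e f)
    ; presVF = λ v f → trans (presVF α _ _) (presVF β v f) }

  autInv : Aut → Aut
  autInv α = record
    { πV = permInv (πV α) ; πE = permInv (πE α) ; πF = permInv (πF α)
    ; presVE = λ v e → trans (sym (presVE α (from (πV α) v) (from (πE α) e)))
                 (Relation.Binary.PropositionalEquality.cong₂ VE (to-from (πV α) v) (to-from (πE α) e))
    ; presEF = λ e f → trans (sym (presEF α (from (πE α) e) (from (πF α) f)))
                 (Relation.Binary.PropositionalEquality.cong₂ EF (to-from (πE α) e) (to-from (πF α) f))
    ; presVF = λ v f → trans (sym (presVF α (from (πV α) v) (from (πF α) f)))
                 (Relation.Binary.PropositionalEquality.cong₂ VF (to-from (πV α) v) (to-from (πF α) f)) }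

  eval : Aut → Aut → Word → Aut
  eval s₁ s₂ σ₁      = s₁
  eval s₁ s₂ σ₂      = s₂
  eval s₁ s₂ ε       = autId
  eval s₁ s₂ (w · u) = autComp (eval s₁ s₂ w) (eval s₁ s₂ u)
  eval s₁ s₂ (inv w) = autInv (eval s₁ s₂ w)

  Chiral : Set
  Chiral = Σ (Flag → Bool) λ c →
             (∀ i Φ Ψ → Adj i Φ Ψ → c Φ ≢ c Ψ)
           × (∀ Φ Ψ → c Φ ≡ c Ψ → Σ Aut λ α → SameFlag (act α Φ) Ψ)
           × ¬ (∀ Φ Ψ → Σ Aut λ α → SameFlag (act α Φ) Ψ)

  -- Γ^{p,q}(i₁,j₁,i₂,j₂) is the automorphism group of P: for some base flag Φ,
  -- with σ₁ : Φ ↦ (Φ^1)^0 and σ₂ : Φ ↦ (Φ^2)^1, the word map Γ → Aut(P)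
  -- is well defined, injective and surjective.
  IsAutGroupOf : ℕ → ℕ → ℤ → ℤ → ℤ → ℤ → Set
  IsAutGroupOf p q i₁ j₁ i₂ j₂ =
    Σ Flag λ Φ → Σ Aut λ s₁ → Σ Aut λ s₂ →
      (Σ Flag λ Φ₁ → Σ Flag λ Φ₁₀ →
         Adj (suc zero) Φ Φ₁ × Adj zero Φ₁ Φ₁₀ × SameFlag (act s₁ Φ) Φ₁₀)
    × (Σ Flag λ Φ₂ → Σ Flag λ Φ₂₁ →
         Adj (suc (suc zero)) Φ Φ₂ × Adj (suc zero) Φ₂ Φ₂₁ × SameFlag (act s₂ Φ) Φ₂₁)
    × (∀ w u → ΓRel p q i₁ j₁ i₂ j₂ w u → AutEq (eval s₁ s₂ w) (eval s₁ s₂ u))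
    × (∀ w u → AutEq (eval s₁ s₂ w) (eval s₁ s₂ u) → ΓRel p q i₁ j₁ i₂ j₂ w u)
    × (∀ α → Σ Word λ w → AutEq α (eval s₁ s₂ w))

IsAutGroupOfTightChiral : ℕ → ℕ → ℤ → ℤ → ℤ → ℤ → Set
IsAutGroupOfTightChiral p q i₁ j₁ i₂ j₂ =
  Σ Incidence λ P →
    IsPolyhedron P × HasType P p q × Tight P p q × Chiral P × IsAutGroupOf P p q i₁ j₁ i₂ j₂

{-# OPTIONS --safe #-}

-- Put M = 2^α = 2m, N = 2^β and u = ±2^(β−3), so that the two groups have
-- σ₂⁻¹σ₁ = σ₁³σ₂^(1+2u) and σ₂σ₁⁻¹ = σ₁⁻³σ₂^(−1+2u). The first relation and
-- (σ₁σ₂)² = 1 give σ₂σ₁² = σ₁²σ₂^(1+2u), so every element is some σ₁ⁱσ₂ʲ and the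
-- group has order at most MN.
--
-- The coset geometry of ⟨σ₂⟩, ⟨σ₂σ₁⟩, ⟨σ₁⟩ can be written down explicitly: vertices
-- are the integers mod M, faces the integers mod N, and the edge (k , j), with k
-- mod m and j mod N, joins the vertices 2k and 2k−1−2j and separates the faces j and
-- j+1−2uk. Here σ₁ acts by i ↦ i+1 on vertices and j ↦ −j−uj(j−1) on faces, and σ₂
-- acts by j ↦ j+1 on faces and fixes even vertices while i ↦ i−2 on odd ones.
--
-- An automorphism fixing the vertex 0 and the face 0 either fixes the two edges
-- between them, and then, walking around both, everything, or swaps them and
-- then acts as a reflection i ↦ −i, j ↦ −j, which the twist 2u excludes. Hence the
-- polyhedron is chiral, the defining relations need only be tested at the vertex 0
-- and the face 0, and normal forms are told apart by their action on these.
module Submission where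

open import Defs
open import Algebra.Bundles using (Group)
import Algebra.Properties.Group as GroupProperties
open import Data.Bool using (Bool; true; false; not; _∧_; _∨_; if_then_else_)
open import Data.Bool.Properties using (∨-comm; not-injective; not-involutive; not-¬)
open import Data.Empty using (⊥; ⊥-elim)
open import Data.Fin using (Fin; zero; suc; toℕ; fromℕ<; splitAt; join; combine; remQuot)
open import Data.Fin.Properties using (suc-injective; injective⇒≤; toℕ-fromℕ<; toℕ-injective; toℕ<n; _≟_; splitAt-join; join-splitAt; remQuot-combine; combine-remQuot)
open import Data.Integer using (ℤ; +_; -[1+_]; -_; ∣_∣; _/ℕ_; _%ℕ_) renaming (NonZero to NonZeroℤ; _+_ to _+ℤ_; _-_ to _-ℤ_; _*_ to _*ℤ_)
open import Data.Integer.DivMod using (n%ℕd<d; a≡a%ℕn+[a/ℕn]*n)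
import Data.Integer.Properties as ℤₚ
open import Data.Integer.Tactic.RingSolver using (solve-∀)
open import Data.Nat using (ℕ; zero; suc; _+_; _*_; _∸_; _^_; _≤_; NonZero; _%_; s≤s; z≤n)
open import Data.Nat.DivMod using (m<n⇒m%n≡m; [m+kn]%n≡m%n)
import Data.Nat.Properties as ℕₚ
open import Data.Product using (Σ; ∃; _×_; _,_; proj₁; proj₂)
open import Data.Sum using (_⊎_; inj₁; inj₂)
open import Data.Sum.Properties using (inj₁-injective)
open import Data.Unit using (⊤; tt)
open import Relation.Binary.PropositionalEquality using (_≡_; _≢_; refl; trans; sym; cong; cong₂; subst; subst₂; module ≡-Reasoning)
import Relation.Binary.Reasoning.Setoid as SetoidReasoning
open import Relation.Nullary using (¬_; does; yes; no)
open import Relation.Nullary.Decidable using (dec-true; dec-false)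

-- Normal forms bound the group from above only; the geometry, found by computing in the group,
-- gives the opposite bound. Its formulas are first order in u, as 2u² and u³ vanish modulo N. The
-- coset of the edge (k , j) consists of g = σ₂^j σ₁^(2k) and gσ₂σ₁, and σ₁^(2k)σ₂ =
-- σ₂^(1-2uk)σ₁^(2k) gives the second face. Since σ₁ maps the edge (0 , j) to (-j , θ(j+1)), whose
-- second face must be θ(j), the face map θ satisfies θ(0) = 0 and θ(j+1) = θ(j) - 1 - 2uj.
-- Summation gives -j - uj(j-1); here u enters instead of 2u, so that vanishing arguments use that
-- j(j-1) is even.
--
-- The twist 2u is a quarter of N up to sign. That 8u is 0 modulo N makes the second face depend on
-- k modulo m only, as 4 divides m; that 4u is not 0 gives chirality. At the vertex 0 edges join
-- consecutive faces j and j+1, a pattern preserved by j ↦ -j, so a reflection is not excluded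
-- there. At the vertices 2 and -2 the steps between faces are 1-2u and 1+2u; a reflection would
-- have to match them, and they differ by 4u.

-- Counting, and sets of two elements.

nth : ∀ n (b : Fin n → Bool) → Fin (count n b) → Fin n
nth (suc n) b i with b zero
nth (suc n) b zero    | true  = zero
nth (suc n) b (suc i) | true  = suc (nth n (λ x → b (suc x)) i)
nth (suc n) b i       | false = suc (nth n (λ x → b (suc x)) i)

nth-true : ∀ n (b : Fin n → Bool) (i : Fin (count n b)) → b (nth n b i) ≡ true
nth-true (suc n) b i with b zero in eq
nth-true (suc n) b zero    | true  = eq
nth-true (suc n) b (suc i) | true  = nth-true n (λ x → b (suc x)) i
nth-true (suc n) b i       | false = nth-true n (λ x → b (suc x)) i

nth-injective : ∀ n (b : Fin n → Bool) {i j : Fin (count n b)} → nth n b i ≡ nth n b j → i ≡ j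
nth-injective (suc n) b {i} {j} eq with b zero
nth-injective (suc n) b {zero}  {zero}  eq | true  = refl
nth-injective (suc n) b {suc i} {suc j} eq | true  = cong suc (nth-injective n _ (suc-injective eq))
nth-injective (suc n) b {i}     {j}     eq | false = nth-injective n _ (suc-injective eq)

nth-surjective : ∀ n (b : Fin n → Bool) x → b x ≡ true → ∃ λ i → nth n b i ≡ x
nth-surjective (suc n) b x bx with b zero in eq
nth-surjective (suc n) b zero    bx | true  = zero , refl
nth-surjective (suc n) b (suc x) bx | true  =
  let i , p = nth-surjective n (λ y → b (suc y)) x bx in suc i , cong suc p
nth-surjective (suc n) b zero    bx | false with () ← trans (sym eq) bx
nth-surjective (suc n) b (suc x) bx | false =
  let i , p = nth-surjective n (λ y → b (suc y)) x bx in i , cong suc p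

-- `nth` enumerates the indices with value `true`. Composed with the inverse of `g` it injects
-- `Fin (count n b)` into `Fin k`, and `g` gives an injection back; the two sizes bound each other.
count-bijection : ∀ {k n} (b : Fin n → Bool) (g : Fin k → Fin n) →
  (∀ {i j} → g i ≡ g j → i ≡ j) → (∀ i → b (g i) ≡ true) →
  (∀ x → b x ≡ true → ∃ λ i → g i ≡ x) → count n b ≡ k
count-bijection {k} {n} b g g-inj g-true g-surj = ℕₚ.≤-antisym
  (injective⇒≤ {f = λ i → proj₁ (g-surj (nth n b i) (nth-true n b i))}
    λ {i} {j} eq → nth-injective n b
      (trans (sym (proj₂ (g-surj (nth n b i) (nth-true n b i))))
        (trans (cong g eq) (proj₂ (g-surj (nth n b j) (nth-true n b j))))))
  (injective⇒≤ {f = λ i → proj₁ (nth-surjective n b (g i) (g-true i))}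
    λ {i} {j} eq → g-inj
      (trans (sym (proj₂ (nth-surjective n b (g i) (g-true i))))
        (trans (cong (nth n b) eq) (proj₂ (nth-surjective n b (g j) (g-true j))))))

sumFin-cong : ∀ n {g h : Fin n → ℕ} → (∀ i → g i ≡ h i) → sumFin n g ≡ sumFin n h
sumFin-cong zero    eq = refl
sumFin-cong (suc n) eq = cong₂ _+_ (eq zero) (sumFin-cong n (λ i → eq (suc i)))

sumFin-const : ∀ n c → sumFin n (λ _ → c) ≡ n * c
sumFin-const zero    c = refl
sumFin-const (suc n) c = cong (λ x → c + x) (sumFin-const n c)

sumFin-if : ∀ n (b : Fin n → Bool) c → sumFin n (λ i → if b i then c else 0) ≡ count n b * c
sumFin-if zero    b c = refl
sumFin-if (suc n) b c with b zero
... | true  = cong (λ x → c + x) (sumFin-if n (λ i → b (suc i)) c)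
... | false = sumFin-if n (λ i → b (suc i)) c

≢-≢⇒≡ : ∀ {x y z : Bool} → y ≢ x → z ≢ x → y ≡ z
≢-≢⇒≡ {x}     {true}  {true}  p q = refl
≢-≢⇒≡ {x}     {false} {false} p q = refl
≢-≢⇒≡ {true}  {true}  {false} p q = ⊥-elim (p refl)
≢-≢⇒≡ {false} {true}  {false} p q = ⊥-elim (q refl)
≢-≢⇒≡ {true}  {false} {true}  p q = ⊥-elim (q refl)
≢-≢⇒≡ {false} {false} {true}  p q = ⊥-elim (p refl)

∧-true : ∀ {x y} → x ∧ y ≡ true → x ≡ true × y ≡ true
∧-true {true} {true} refl = refl , refl

-- With a Boolean key such a set has at most two elements. In a flat map the key is the flag class,
-- the source of all counts equal to two.
Separates : {X : Set} → (X → Set) → (X → Bool) → Set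
Separates S key = ∀ {x y} → S x → S y → key x ≡ key y → x ≡ y

-- Both `y` and `z` carry the key that `x` does not.
two-of : ∀ {X : Set} {S : X → Set} {key : X → Bool} → Separates S key →
  ∀ {x y z} → S x → S y → S z → y ≢ x → z ≢ x → y ≡ z
two-of sep Sx Sy Sz y≢x z≢x =
  sep Sy Sz (≢-≢⇒≡ (λ eq → y≢x (sep Sy Sx eq)) (λ eq → z≢x (sep Sz Sx eq)))

count-two : ∀ {n} (b : Fin n → Bool) (key : Fin n → Bool) → Separates (λ x → b x ≡ true) key →
  (∀ c → ∃ λ x → b x ≡ true × key x ≡ c) → count n b ≡ 2
count-two {n} b key sep ex = count-bijection b g g-inj g-true g-surj
  where
  pick : Bool → Fin n
  pick c = proj₁ (ex c)
  pick-true : ∀ c → b (pick c) ≡ true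
  pick-true c = proj₁ (proj₂ (ex c))
  pick-key : ∀ c → key (pick c) ≡ c
  pick-key c = proj₂ (proj₂ (ex c))
  g : Fin 2 → Fin n
  g zero       = pick true
  g (suc zero) = pick false
  t≢f : pick true ≢ pick false
  t≢f eq with () ← trans (sym (pick-key true)) (trans (cong key eq) (pick-key false))
  g-inj : ∀ {i j} → g i ≡ g j → i ≡ j
  g-inj {zero}     {zero}     eq = refl
  g-inj {zero}     {suc zero} eq = ⊥-elim (t≢f eq)
  g-inj {suc zero} {zero}     eq = ⊥-elim (t≢f (sym eq))
  g-inj {suc zero} {suc zero} eq = refl
  g-true : ∀ i → b (g i) ≡ true
  g-true zero       = pick-true true
  g-true (suc zero) = pick-true false
  g-surj : ∀ x → b x ≡ true → ∃ λ i → g i ≡ x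
  g-surj x bx with key x in eq
  ... | true  = zero , sep (pick-true true) bx (trans (pick-key true) (sym eq))
  ... | false = suc zero , sep (pick-true false) bx (trans (pick-key false) (sym eq))

-- Walks around a vertex or a face.

iter : {X : Set} → (X → X) → ℕ → X → X
iter f zero    x = x
iter f (suc n) x = f (iter f n x)

-- Going round a vertex or a face: consecutive steps are forced, so two
-- walks with a common start coincide.
module Walks {X E : Set} (I : E → X → Set)
  (two-X : ∀ {e x y z} → I e x → I e y → I e z → y ≢ x → z ≢ x → y ≡ z)
  (two-E : ∀ {x d e f} → I d x → I e x → I f x → e ≢ d → f ≢ d → e ≡ f) where

  record Walk (xs : ℕ → X) (es : ℕ → E) : Set where
    field
      near : ∀ n → I (es n) (xs n)
      far  : ∀ n → I (es n) (xs (suc n))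
      xs≢  : ∀ n → xs (suc n) ≢ xs n
      es≢  : ∀ n → es (suc n) ≢ es n
  open Walk

  walk-unique : ∀ {xs es ys ds} → Walk xs es → Walk ys ds → xs 0 ≡ ys 0 → es 0 ≡ ds 0 →
    ∀ n → xs n ≡ ys n × es n ≡ ds n
  walk-unique W Z x≡ e≡ zero = x≡ , e≡
  walk-unique {xs} {es} {ys} {ds} W Z x≡ e≡ (suc n) with walk-unique W Z x≡ e≡ n
  ... | xn , en = x' , two-E (far W n) (near W (suc n)) (subst (I _) (sym x') (near Z (suc n)))
                         (es≢ W n) (λ eq → es≢ Z n (trans eq en))
    where
    x' : xs (suc n) ≡ ys (suc n)
    x' = two-X (near W n) (far W n) (subst (λ e → I e _) (sym en) (far Z n))
           (xs≢ W n) (λ eq → xs≢ Z n (trans eq xn))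

  record Symmetry : Set where
    field
      onX : X → X
      onE : E → E
      pres : ∀ {e x} → I e x → I (onE e) (onX x)
      injX : ∀ {x y} → onX x ≡ onX y → x ≡ y
      injE : ∀ {d e} → onE d ≡ onE e → d ≡ e
  open Symmetry

  -- One step from `x` across `e` in the direction of `σ`; iterating `σ` extends it to the whole
  -- walk.
  record Start (σ : Symmetry) (x : X) (e : E) : Set where
    field
      near₀ : I e x
      far₀  : I e (onX σ x)
      x≢    : onX σ x ≢ x
      e≢    : onE σ e ≢ e
  open Start

  orbit-walk : ∀ σ {x e} → Start σ x e → Walk (λ n → iter (onX σ) n x) (λ n → iter (onE σ) n e)
  orbit-walk σ {x} {e} s = record { near = nr ; far = fr ; xs≢ = xd ; es≢ = ed }
    where
    nr : ∀ n → I (iter (onE σ) n e) (iter (onX σ) n x)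
    nr zero    = near₀ s
    nr (suc n) = pres σ (nr n)
    fr : ∀ n → I (iter (onE σ) n e) (iter (onX σ) (suc n) x)
    fr zero    = far₀ s
    fr (suc n) = pres σ (fr n)
    xd : ∀ n → iter (onX σ) (suc n) x ≢ iter (onX σ) n x
    xd zero    eq = x≢ s eq
    xd (suc n) eq = xd n (injX σ eq)
    ed : ∀ n → iter (onE σ) (suc n) e ≢ iter (onE σ) n e
    ed zero    eq = e≢ s eq
    ed (suc n) eq = ed n (injE σ eq)

  walk-image : ∀ γ {xs es} → Walk xs es → Walk (λ n → onX γ (xs n)) (λ n → onE γ (es n))
  walk-image γ W = record
    { near = λ n → pres γ (near W n)
    ; far  = λ n → pres γ (far W n)
    ; xs≢  = λ n eq → xs≢ W n (injX γ eq)
    ; es≢  = λ n eq → es≢ W n (injE γ eq) }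

  -- `γ` carries the walk of `σ` to a walk with the same beginning as that of `τ`, and walks are
  -- unique. With `τ` equal to `σ` this shows that `γ` fixes the orbit, with `τ` inverse to `σ` that
  -- it reverses it.
  symmetry-on-orbit : ∀ γ σ τ {x d e} → Start σ x d → Start τ x e → onX γ x ≡ x → onE γ d ≡ e →
    ∀ n → onX γ (iter (onX σ) n x) ≡ iter (onX τ) n x
  symmetry-on-orbit γ σ τ s t γx γd n =
    proj₁ (walk-unique (walk-image γ (orbit-walk σ s)) (orbit-walk τ t) γx γd n)

-- Flat maps: type, tightness and connectedness.

-- A tight polyhedron is flat: every vertex lies on every face. Hence a flag is
-- determined by its colour (the orbit of the rotation group), vertex and face.
record FlatMap : Set where
  field
    nV nE nF : ℕ
    VE : Fin nV → Fin nE → Bool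
    EF : Fin nE → Fin nF → Bool
    colour : Fin nV → Fin nE → Fin nF → Bool
    edgeOf : Bool → Fin nV → Fin nF → Fin nE
    edgeOf-VE : ∀ c v f → VE v (edgeOf c v f) ≡ true
    edgeOf-EF : ∀ c v f → EF (edgeOf c v f) f ≡ true
    edgeOf-colour : ∀ c v f → colour v (edgeOf c v f) f ≡ c
    edgeOf-unique : ∀ v e f → VE v e ≡ true → EF e f ≡ true → e ≡ edgeOf (colour v e f) v f
    colour-vertex : ∀ e f → Separates (λ v → VE v e ≡ true) (λ v → colour v e f)
    colour-face   : ∀ v e → Separates (λ f → EF e f ≡ true) (λ f → colour v e f)
    vertexOf : ∀ e f c → ∃ λ v → VE v e ≡ true × colour v e f ≡ c
    faceOf   : ∀ v e c → ∃ λ f → EF e f ≡ true × colour v e f ≡ c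
    v₀ : Fin nV
    f₀ : Fin nF

  incidence : Incidence
  incidence = record { nV = nV ; nE = nE ; nF = nF ; VE = VE ; EF = EF ; VF = λ _ _ → true
                     ; trans-VEF = λ _ _ _ _ _ → refl }

  At : Fin nV → Fin nF → Fin nE → Set
  At v f e = VE v e ≡ true × EF e f ≡ true

  edge-unique : ∀ {v f d e} → At v f d → At v f e → colour v d f ≡ colour v e f → d ≡ e
  edge-unique {v} {f} {d} {e} (p , q) (r , s) eq =
    trans (edgeOf-unique v d f p q)
      (trans (cong (λ c → edgeOf c v f) eq) (sym (edgeOf-unique v e f r s)))

  -- On a given face the two vertices of an edge get different colours, so exactly one of them sees
  -- the edge with colour `true`: the edges of a face correspond to the vertices. Dually the edges
  -- at a vertex correspond to the faces.
  edge-degrees : HasType incidence nV nF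
  edge-degrees =
    (λ f → count-bijection (λ e → EF e f) (λ v → edgeOf true v f)
      (λ {v} {w} eq → colour-vertex (edgeOf true v f) f (edgeOf-VE true v f)
        (subst (λ e → VE w e ≡ true) (sym eq) (edgeOf-VE true w f))
        (trans (edgeOf-colour true v f)
          (sym (trans (cong (λ e → colour w e f) eq) (edgeOf-colour true w f)))))
      (λ v → edgeOf-EF true v f)
      (λ e ef → let v , ve , c = vertexOf e f true in
        v , sym (trans (edgeOf-unique v e f ve ef) (cong (λ c → edgeOf c v f) c)))) ,
    (λ v → count-bijection (λ e → VE v e) (λ f → edgeOf true v f)
      (λ {f} {g} eq → colour-face v (edgeOf true v f) (edgeOf-EF true v f)
        (subst (λ e → EF e g ≡ true) (sym eq) (edgeOf-EF true v g))
        (trans (edgeOf-colour true v f)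
          (sym (trans (cong (λ e → colour v e g) eq) (edgeOf-colour true v g)))))
      (λ f → edgeOf-VE true v f)
      (λ e ve → let f , ef , c = faceOf v e true in
        f , sym (trans (edgeOf-unique v e f ve ef) (cong (λ c → edgeOf c v f) c))))

  two-vertices : ∀ e → count nV (λ v → VE v e) ≡ 2
  two-vertices e = count-two (λ v → VE v e) (λ v → colour v e f₀) (colour-vertex e f₀) (vertexOf e f₀)

  two-faces : ∀ e → count nF (λ f → EF e f) ≡ 2
  two-faces e = count-two (λ f → EF e f) (λ f → colour v₀ e f) (colour-face v₀ e) (faceOf v₀ e)

  two-edges : ∀ v f → count nE (λ e → VE v e ∧ EF e f) ≡ 2
  two-edges v f = count-two (λ e → VE v e ∧ EF e f) (λ e → colour v e f)
    (λ p q → edge-unique (∧-true p) (∧-true q))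
    (λ c → edgeOf c v f , cong₂ _∧_ (edgeOf-VE c v f) (edgeOf-EF c v f) , edgeOf-colour c v f)

  tight : Tight incidence nV nF
  tight = begin
    sumFin nV (λ v → sumFin nE (λ e → sumFin nF (λ f → if VE v e ∧ EF e f ∧ true then 1 else 0)))
      ≡⟨ sumFin-cong nV (λ v → sumFin-cong nE (λ e → faces (VE v e) e)) ⟩
    sumFin nV (λ v → sumFin nE (λ e → if VE v e then 2 else 0))
      ≡⟨ sumFin-cong nV (λ v → trans (sumFin-if nE (VE v) 2) (cong (_* 2) (proj₂ edge-degrees v))) ⟩
    sumFin nV (λ _ → nF * 2)
      ≡⟨ sumFin-const nV (nF * 2) ⟩
    nV * (nF * 2)
      ≡⟨ sym (ℕₚ.*-assoc nV nF 2) ⟩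
    nV * nF * 2
      ≡⟨ ℕₚ.*-comm (nV * nF) 2 ⟩
    2 * (nV * nF)
      ≡⟨ sym (ℕₚ.*-assoc 2 nV nF) ⟩
    2 * nV * nF ∎
    where
    open ≡-Reasoning
    ∧-true-if : ∀ x → (if x ∧ true then 1 else 0) ≡ (if x then 1 else 0)
    ∧-true-if true  = refl
    ∧-true-if false = refl
    faces : ∀ x e → sumFin nF (λ f → if x ∧ EF e f ∧ true then 1 else 0) ≡ (if x then 2 else 0)
    faces true  e = trans (sumFin-cong nF (λ f → ∧-true-if (EF e f)))
      (trans (sumFin-if nF (EF e) 1) (trans (ℕₚ.*-identityʳ _) (two-faces e)))
    faces false e = trans (sumFin-const nF 0) (ℕₚ.*-zeroʳ nF)

  two-vertices′ : ∀ {f e x y z} → At x f e → At y f e → At z f e → y ≢ x → z ≢ x → y ≡ z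
  two-vertices′ {f} {e} p q r = two-of (colour-vertex e f) (proj₁ p) (proj₁ q) (proj₁ r)

  two-faces′ : ∀ {v e x y z} → At v x e → At v y e → At v z e → y ≢ x → z ≢ x → y ≡ z
  two-faces′ {v} {e} p q r = two-of (colour-face v e) (proj₂ p) (proj₂ q) (proj₂ r)

  two-edges′ : ∀ {v f x y z} → At v f x → At v f y → At v f z → y ≢ x → z ≢ x → y ≡ z
  two-edges′ = two-of edge-unique

  -- All vertices lie on all faces, so `v₀` is at most two steps away; an edge is reached through
  -- one of its faces.
  connected′ : ConnectedOn incidence (λ _ → ⊤)
  connected′ x y _ _ = from-v₀ (to-v₀ x) y
    where
    Pth : Elt incidence → Elt incidence → Set
    Pth = Path incidence (λ _ → ⊤)
    v : Fin nV → Elt incidence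
    v = inj₁
    f : Fin nF → Elt incidence
    f x = inj₂ (inj₂ x)
    to-v₀ : ∀ x → Pth x (v v₀)
    to-v₀ (inj₁ w)        = step (step {z = f f₀} (here tt) refl tt) refl tt
    to-v₀ (inj₂ (inj₂ g)) = step (here tt) refl tt
    to-v₀ (inj₂ (inj₁ e)) =
      step (step {z = f (proj₁ (faceOf v₀ e true))} (here tt) (proj₁ (proj₂ (faceOf v₀ e true))) tt) refl tt
    from-v₀ : ∀ {x} → Pth x (v v₀) → ∀ y → Pth x y
    from-v₀ p (inj₁ w)        = step (step {z = f f₀} p refl tt) refl tt
    from-v₀ p (inj₂ (inj₂ g)) = step p refl tt
    from-v₀ p (inj₂ (inj₁ e)) =
      step (step {z = f (proj₁ (faceOf v₀ e true))} p refl tt) (proj₁ (proj₂ (faceOf v₀ e true))) tt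

-- Normal forms in the presented group.

half : ∀ i → ∃ λ k → i ≡ k * 2 ⊎ i ≡ suc (k * 2)
half zero = 0 , inj₁ refl
half (suc i) with half i
... | k , inj₁ eq = k , inj₂ (cong suc eq)
... | k , inj₂ eq = suc k , inj₁ (cong suc eq)

-- The subgroup ⟨σ₁²⟩ normalises ⟨σ₂⟩, which brings every word to the form σ₁ⁱσ₂ʲ.
module NormalForm (p q : ℕ) .{{_ : NonZero p}} .{{_ : NonZero q}} (j₁ i₂ j₂ : ℤ) where

  infix 4 _~_
  _~_ : Word → Word → Set
  _~_ = ΓRel p q (+ 3) j₁ i₂ j₂

  Γ : Group _ _
  Γ = record
    { Carrier = Word ; _≈_ = _~_ ; _∙_ = _·_ ; ε = ε ; _⁻¹ = inv
    ; isGroup = record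
      { isMonoid = record
        { isSemigroup = record
          { isMagma = record
            { isEquivalence = record { refl = rfl ; sym = sy ; trans = tr }
            ; ∙-cong = ·-cong }
          ; assoc = λ _ _ _ → assoc }
        ; identity = (λ _ → idˡ) , (λ _ → idʳ) }
      ; inverse = (λ _ → invˡ) , (λ _ → invʳ)
      ; ⁻¹-cong = inv-cong } }

  open GroupProperties Γ using (inverseʳ-unique; ⁻¹-anti-homo-∙; ⁻¹-involutive)
  open SetoidReasoning (Group.setoid Γ)

  pow-+ : ∀ x m n → powℕ x (m + n) ~ powℕ x m · powℕ x n
  pow-+ x zero    n = sy idˡ
  pow-+ x (suc m) n = tr (·-cong rfl (pow-+ x m n)) (sy assoc)

  pow-* : ∀ x m n → powℕ (powℕ x m) n ~ powℕ x (n * m)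
  pow-* x m zero    = rfl
  pow-* x m (suc n) = tr (·-cong rfl (pow-* x m n)) (sy (pow-+ x m (n * m)))

  pow-cong : ∀ {x y} n → x ~ y → powℕ x n ~ powℕ y n
  pow-cong zero    eq = rfl
  pow-cong (suc n) eq = ·-cong eq (pow-cong n eq)

  pow-ε : ∀ n → powℕ ε n ~ ε
  pow-ε zero    = rfl
  pow-ε (suc n) = tr idˡ (pow-ε n)

  pow-multiple : ∀ {x r} → powℕ x r ~ ε → ∀ k → powℕ x (k * r) ~ ε
  pow-multiple {x} {r} eq k = tr (sy (pow-* x r k)) (tr (pow-cong k eq) (pow-ε k))

  -- Finite order makes an inverse a positive power, so that normal forms need natural exponents
  -- only.
  inv-pow : ∀ x r .{{_ : NonZero r}} → powℕ x r ~ ε → ∃ λ n → ∀ i → inv (powℕ x i) ~ powℕ x (n * i)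
  inv-pow x (suc r) eq = r , λ i → sy (inverseʳ-unique (powℕ x i) (powℕ x (r * i)) (begin
    powℕ x i · powℕ x (r * i)  ≈⟨ sy (pow-+ x i (r * i)) ⟩
    powℕ x (suc r * i)         ≡⟨ cong (powℕ x) (ℕₚ.*-comm (suc r) i) ⟩
    powℕ x (i * suc r)         ≈⟨ pow-multiple eq i ⟩
    ε                          ∎))

  inv-σ₁^ : ∃ λ n → ∀ i → inv (powℕ σ₁ i) ~ powℕ σ₁ (n * i)
  inv-σ₁^ = inv-pow σ₁ p rel₁

  inv-σ₂^ : ∃ λ n → ∀ i → inv (powℕ σ₂ i) ~ powℕ σ₂ (n * i)
  inv-σ₂^ = inv-pow σ₂ q rel₂

  inv-σ₁ : ∃ λ n → inv σ₁ ~ powℕ σ₁ n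
  inv-σ₁ = _ , tr (inv-cong (sy idʳ)) (proj₂ inv-σ₁^ 1)

  inv-σ₂ : ∃ λ n → inv σ₂ ~ powℕ σ₂ n
  inv-σ₂ = _ , tr (inv-cong (sy idʳ)) (proj₂ inv-σ₂^ 1)

  powℤ-σ₂ : ∀ z → ∃ λ n → powℤ σ₂ z ~ powℕ σ₂ n
  powℤ-σ₂ (+ n)    = n , rfl
  powℤ-σ₂ -[1+ n ] = _ , tr (pow-cong (suc n) (proj₂ inv-σ₂)) (pow-* σ₂ _ (suc n))

  -- Being conjugate to `σ₁ · σ₂`, the product `σ₂ · σ₁` also squares to the identity and equals its
  -- own inverse.
  σ₂σ₁ : σ₂ · σ₁ ~ inv σ₁ · inv σ₂
  σ₂σ₁ = begin
    σ₂ · σ₁                    ≈⟨ sy (⁻¹-involutive (σ₂ · σ₁)) ⟩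
    inv (inv (σ₂ · σ₁))        ≈⟨ inv-cong (⁻¹-anti-homo-∙ σ₂ σ₁) ⟩
    inv (inv σ₁ · inv σ₂)      ≈⟨ sy (inverseʳ-unique (inv σ₁ · inv σ₂) (inv σ₁ · inv σ₂) square) ⟩
    inv σ₁ · inv σ₂            ∎
    where
    square : (inv σ₁ · inv σ₂) · (inv σ₁ · inv σ₂) ~ ε
    square = begin
      (inv σ₁ · inv σ₂) · (inv σ₁ · inv σ₂)    ≈⟨ assoc ⟩
      inv σ₁ · (inv σ₂ · (inv σ₁ · inv σ₂))    ≈⟨ ·-cong rfl (sy assoc) ⟩
      inv σ₁ · ((inv σ₂ · inv σ₁) · inv σ₂)    ≈⟨ ·-cong rfl (·-cong (sy (⁻¹-anti-homo-∙ σ₁ σ₂)) rfl) ⟩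
      inv σ₁ · (inv (σ₁ · σ₂) · inv σ₂)        ≈⟨ ·-cong rfl (·-cong (sy (inverseʳ-unique _ _ (tr (·-cong rfl (sy idʳ)) rel₃))) rfl) ⟩
      inv σ₁ · ((σ₁ · σ₂) · inv σ₂)            ≈⟨ ·-cong rfl (tr assoc (tr (·-cong rfl invʳ) idʳ)) ⟩
      inv σ₁ · σ₁                              ≈⟨ invˡ ⟩
      ε                                        ∎

  n₀ : ℕ
  n₀ = proj₁ (powℤ-σ₂ j₁)

  -- Replacing `σ₂ · σ₁` by its inverse exposes `inv σ₂ · σ₁`. The cube of `σ₁` in the relation for
  -- the latter loses one factor to the leading `inv σ₁`, which leaves the even power 2: this is the
  -- effect of the exponent 3.
  σ₂σ₁² : σ₂ · (σ₁ · σ₁) ~ (σ₁ · σ₁) · powℕ σ₂ n₀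
  σ₂σ₁² = begin
    σ₂ · (σ₁ · σ₁)                                ≈⟨ sy assoc ⟩
    (σ₂ · σ₁) · σ₁                                ≈⟨ ·-cong σ₂σ₁ rfl ⟩
    (inv σ₁ · inv σ₂) · σ₁                        ≈⟨ assoc ⟩
    inv σ₁ · (inv σ₂ · σ₁)                        ≈⟨ ·-cong rfl rel₄ ⟩
    inv σ₁ · ((σ₁ · (σ₁ · (σ₁ · ε))) · powℤ σ₂ j₁) ≈⟨ sy assoc ⟩
    (inv σ₁ · (σ₁ · (σ₁ · (σ₁ · ε)))) · powℤ σ₂ j₁ ≈⟨ ·-cong (tr (sy assoc) (tr (·-cong invˡ (·-cong rfl idʳ)) idˡ)) (proj₂ (powℤ-σ₂ j₁)) ⟩
    (σ₁ · σ₁) · powℕ σ₂ n₀                        ∎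

  σ₂^σ₁² : ∀ m → powℕ σ₂ m · (σ₁ · σ₁) ~ (σ₁ · σ₁) · powℕ σ₂ (m * n₀)
  σ₂^σ₁² zero    = tr idˡ (sy idʳ)
  σ₂^σ₁² (suc m) = begin
    (σ₂ · powℕ σ₂ m) · (σ₁ · σ₁)                    ≈⟨ assoc ⟩
    σ₂ · (powℕ σ₂ m · (σ₁ · σ₁))                    ≈⟨ ·-cong rfl (σ₂^σ₁² m) ⟩
    σ₂ · ((σ₁ · σ₁) · powℕ σ₂ (m * n₀))             ≈⟨ sy assoc ⟩
    (σ₂ · (σ₁ · σ₁)) · powℕ σ₂ (m * n₀)             ≈⟨ ·-cong σ₂σ₁² rfl ⟩
    ((σ₁ · σ₁) · powℕ σ₂ n₀) · powℕ σ₂ (m * n₀)     ≈⟨ assoc ⟩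
    (σ₁ · σ₁) · (powℕ σ₂ n₀ · powℕ σ₂ (m * n₀))     ≈⟨ ·-cong rfl (sy (pow-+ σ₂ n₀ (m * n₀))) ⟩
    (σ₁ · σ₁) · powℕ σ₂ (n₀ + m * n₀)               ∎

  σ₂^σ₁^even : ∀ m k → ∃ λ n → powℕ σ₂ m · powℕ (σ₁ · σ₁) k ~ powℕ (σ₁ · σ₁) k · powℕ σ₂ n
  σ₂^σ₁^even m zero    = m , tr idʳ (sy idˡ)
  σ₂^σ₁^even m (suc k) = let n , eq = σ₂^σ₁^even (m * n₀) k in n , (begin
    powℕ σ₂ m · ((σ₁ · σ₁) · powℕ (σ₁ · σ₁) k)            ≈⟨ sy assoc ⟩
    (powℕ σ₂ m · (σ₁ · σ₁)) · powℕ (σ₁ · σ₁) k            ≈⟨ ·-cong (σ₂^σ₁² m) rfl ⟩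
    ((σ₁ · σ₁) · powℕ σ₂ (m * n₀)) · powℕ (σ₁ · σ₁) k     ≈⟨ assoc ⟩
    (σ₁ · σ₁) · (powℕ σ₂ (m * n₀) · powℕ (σ₁ · σ₁) k)     ≈⟨ ·-cong rfl eq ⟩
    (σ₁ · σ₁) · (powℕ (σ₁ · σ₁) k · powℕ σ₂ n)            ≈⟨ sy assoc ⟩
    ((σ₁ · σ₁) · powℕ (σ₁ · σ₁) k) · powℕ σ₂ n            ∎)

  σ₁²^ : ∀ k → powℕ (σ₁ · σ₁) k ~ powℕ σ₁ (k * 2)
  σ₁²^ k = tr (pow-cong k (·-cong rfl (sy idʳ))) (pow-* σ₁ 2 k)

  NF : Word → Set
  NF w = ∃ λ i → ∃ λ j → w ~ powℕ σ₁ i · powℕ σ₂ j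

  -- An even power of `σ₁` lets `σ₂` pass with a changed exponent. For an odd power, `σ₂σ₁` first
  -- uses up one factor `σ₁`, and what remains is even.
  σ₂σ₁^ : ∀ i → NF (σ₂ · powℕ σ₁ i)
  σ₂σ₁^ i with half i
  ... | k , inj₁ refl = let n , eq = σ₂^σ₁^even 1 k in k * 2 , n , (begin
    σ₂ · powℕ σ₁ (k * 2)               ≈⟨ ·-cong (sy idʳ) (sy (σ₁²^ k)) ⟩
    powℕ σ₂ 1 · powℕ (σ₁ · σ₁) k       ≈⟨ eq ⟩
    powℕ (σ₁ · σ₁) k · powℕ σ₂ n       ≈⟨ ·-cong (σ₁²^ k) rfl ⟩
    powℕ σ₁ (k * 2) · powℕ σ₂ n        ∎)
  ... | k , inj₂ refl = let n , eq = σ₂^σ₁^even (proj₁ inv-σ₂) k in proj₁ inv-σ₁ + k * 2 , n , (begin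
    σ₂ · (σ₁ · powℕ σ₁ (k * 2))                              ≈⟨ sy assoc ⟩
    (σ₂ · σ₁) · powℕ σ₁ (k * 2)                              ≈⟨ ·-cong σ₂σ₁ (sy (σ₁²^ k)) ⟩
    (inv σ₁ · inv σ₂) · powℕ (σ₁ · σ₁) k                     ≈⟨ assoc ⟩
    inv σ₁ · (inv σ₂ · powℕ (σ₁ · σ₁) k)                     ≈⟨ ·-cong (proj₂ inv-σ₁) (·-cong (proj₂ inv-σ₂) rfl) ⟩
    powℕ σ₁ (proj₁ inv-σ₁) · (powℕ σ₂ (proj₁ inv-σ₂) · powℕ (σ₁ · σ₁) k) ≈⟨ ·-cong rfl eq ⟩
    powℕ σ₁ (proj₁ inv-σ₁) · (powℕ (σ₁ · σ₁) k · powℕ σ₂ n)  ≈⟨ sy assoc ⟩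
    (powℕ σ₁ (proj₁ inv-σ₁) · powℕ (σ₁ · σ₁) k) · powℕ σ₂ n  ≈⟨ ·-cong (·-cong rfl (σ₁²^ k)) rfl ⟩
    (powℕ σ₁ (proj₁ inv-σ₁) · powℕ σ₁ (k * 2)) · powℕ σ₂ n   ≈⟨ ·-cong (sy (pow-+ σ₁ (proj₁ inv-σ₁) (k * 2))) rfl ⟩
    powℕ σ₁ (proj₁ inv-σ₁ + k * 2) · powℕ σ₂ n               ∎)

  NF-resp : ∀ {w u} → w ~ u → NF u → NF w
  NF-resp eq (i , j , r) = i , j , tr eq r

  NF-σ₁ : ∀ {w} → NF w → NF (σ₁ · w)
  NF-σ₁ (i , j , r) = suc i , j , tr (·-cong rfl r) (sy assoc)

  NF-σ₂ : ∀ {w} → NF w → NF (σ₂ · w)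
  NF-σ₂ {w} (i , j , r) with i′ , j′ , s ← σ₂σ₁^ i = i′ , j′ + j , (begin
    σ₂ · w                                   ≈⟨ ·-cong rfl r ⟩
    σ₂ · (powℕ σ₁ i · powℕ σ₂ j)             ≈⟨ sy assoc ⟩
    (σ₂ · powℕ σ₁ i) · powℕ σ₂ j             ≈⟨ ·-cong s rfl ⟩
    (powℕ σ₁ i′ · powℕ σ₂ j′) · powℕ σ₂ j    ≈⟨ assoc ⟩
    powℕ σ₁ i′ · (powℕ σ₂ j′ · powℕ σ₂ j)    ≈⟨ ·-cong rfl (sy (pow-+ σ₂ j′ j)) ⟩
    powℕ σ₁ i′ · powℕ σ₂ (j′ + j)            ∎)

  NF-pow : ∀ {x} → (∀ {w} → NF w → NF (x · w)) → ∀ n {w} → NF w → NF (powℕ x n · w)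
  NF-pow h zero    nf = NF-resp idˡ nf
  NF-pow h (suc n) nf = NF-resp assoc (h (NF-pow h n nf))

  NF-product : ∀ {w u} → NF w → NF u → NF (w · u)
  NF-product (i , j , r) nf =
    NF-resp (tr (·-cong r rfl) assoc) (NF-pow NF-σ₁ i (NF-pow NF-σ₂ j nf))

  NF-σ₁^ : ∀ i → NF (powℕ σ₁ i)
  NF-σ₁^ i = i , 0 , sy idʳ

  NF-σ₂^ : ∀ j → NF (powℕ σ₂ j)
  NF-σ₂^ j = 0 , j , sy idˡ

  normalForm : ∀ w → NF w
  normalForm σ₁      = NF-resp (sy idʳ) (NF-σ₁^ 1)
  normalForm σ₂      = NF-resp (sy idʳ) (NF-σ₂^ 1)
  normalForm ε       = NF-σ₁^ 0
  normalForm (w · u) = NF-product (normalForm w) (normalForm u)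
  normalForm (inv w) with i , j , r ← normalForm w =
    NF-resp (tr (inv-cong r) (tr (⁻¹-anti-homo-∙ _ _) (·-cong (proj₂ inv-σ₂^ j) (proj₂ inv-σ₁^ i))))
      (NF-product (NF-σ₂^ _) (NF-σ₁^ _))

-- Paths and automorphisms of an incidence structure.

module _ (P : Incidence) where
  open Incidence P

  Inc-sym : ∀ x y → Inc P x y → Inc P y x
  Inc-sym (inj₁ _)        (inj₂ (inj₁ _)) i = i
  Inc-sym (inj₁ _)        (inj₂ (inj₂ _)) i = i
  Inc-sym (inj₂ (inj₁ _)) (inj₁ _)        i = i
  Inc-sym (inj₂ (inj₁ _)) (inj₂ (inj₂ _)) i = i
  Inc-sym (inj₂ (inj₂ _)) (inj₁ _)        i = i
  Inc-sym (inj₂ (inj₂ _)) (inj₂ (inj₁ _)) i = i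

  path-end : ∀ {S x y} → Path P S x y → S y
  path-end (here s)     = s
  path-end (step _ _ s) = s

  path-trans : ∀ {S x y z} → Path P S x y → Path P S y z → Path P S x z
  path-trans p (here _)     = p
  path-trans p (step q i s) = step (path-trans p q) i s

  path-sym : ∀ {S x y} → Path P S x y → Path P S y x
  path-sym (here s) = here s
  path-sym (step {y = y} {z = z} p i s) = path-trans (step (here s) (Inc-sym y z i) (path-end p)) (path-sym p)

  connected-via : ∀ {S} x → (∀ y → S y → Path P S x y) → ConnectedOn P S
  connected-via x paths y z Sy Sz = path-trans (path-sym (paths y Sy)) (paths z Sz)

  actE : Aut P → Elt P → Elt P
  actE α (inj₁ v)        = inj₁ (to (πV α) v)
  actE α (inj₂ (inj₁ e)) = inj₂ (inj₁ (to (πE α) e))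
  actE α (inj₂ (inj₂ f)) = inj₂ (inj₂ (to (πF α) f))

  actE-inv : ∀ α x → actE α (actE (autInv P α) x) ≡ x
  actE-inv α (inj₁ v)        = cong inj₁ (to-from (πV α) v)
  actE-inv α (inj₂ (inj₁ e)) = cong (λ z → inj₂ (inj₁ z)) (to-from (πE α) e)
  actE-inv α (inj₂ (inj₂ f)) = cong (λ z → inj₂ (inj₂ z)) (to-from (πF α) f)

  inv-actE : ∀ α x → actE (autInv P α) (actE α x) ≡ x
  inv-actE α (inj₁ v)        = cong inj₁ (from-to (πV α) v)
  inv-actE α (inj₂ (inj₁ e)) = cong (λ z → inj₂ (inj₁ z)) (from-to (πE α) e)
  inv-actE α (inj₂ (inj₂ f)) = cong (λ z → inj₂ (inj₂ z)) (from-to (πF α) f)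

  actE-Inc : ∀ α x y → Inc P x y → Inc P (actE α x) (actE α y)
  actE-Inc α (inj₁ v)        (inj₂ (inj₁ e)) i = trans (presVE α v e) i
  actE-Inc α (inj₁ v)        (inj₂ (inj₂ f)) i = trans (presVF α v f) i
  actE-Inc α (inj₂ (inj₁ e)) (inj₁ v)        i = trans (presVE α v e) i
  actE-Inc α (inj₂ (inj₁ e)) (inj₂ (inj₂ f)) i = trans (presEF α e f) i
  actE-Inc α (inj₂ (inj₂ f)) (inj₁ v)        i = trans (presVF α v f) i
  actE-Inc α (inj₂ (inj₂ f)) (inj₂ (inj₁ e)) i = trans (presEF α e f) i

  path-image : ∀ α {S T x y} → (∀ z → S z → T (actE α z)) → Path P S x y → Path P T (actE α x) (actE α y)
  path-image α h (here s) = here (h _ s)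
  path-image α h (step {y = y} {z = z} p i s) = step (path-image α h p) (actE-Inc α y z i) (h _ s)

  -- Both ends are pulled back along the inverse of `α`, joined in the link of `z`, and the path is
  -- pushed forward. By transitivity on vertices and on faces one link of each kind is enough.
  link-connected-image : ∀ α z → ConnectedOn P (Inc P z) → ConnectedOn P (Inc P (actE α z))
  link-connected-image α z conn x y ix iy =
    subst₂ (Path P _) (actE-inv α x) (actE-inv α y)
      (path-image α (λ w → actE-Inc α z w)
        (conn (actE α⁻¹ x) (actE α⁻¹ y) (pull x ix) (pull y iy)))
    where
    α⁻¹ : Aut P
    α⁻¹ = autInv P α
    pull : ∀ w → Inc P (actE α z) w → Inc P z (actE α⁻¹ w)
    pull w i = subst (λ t → Inc P t (actE α⁻¹ w)) (inv-actE α z) (actE-Inc α⁻¹ (actE α z) w i)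

  AutEq-trans : ∀ {α β γ} → AutEq P α β → AutEq P β γ → AutEq P α γ
  AutEq-trans (p , q , r) (p′ , q′ , r′) =
    (λ v → trans (p v) (p′ v)) , (λ e → trans (q e) (q′ e)) , (λ f → trans (r f) (r′ f))

  AutEq-sym : ∀ {α β} → AutEq P α β → AutEq P β α
  AutEq-sym (p , q , r) = (λ v → sym (p v)) , (λ e → sym (q e)) , (λ f → sym (r f))

  to-injective : ∀ {n} (π : Perm P n) {x y} → to π x ≡ to π y → x ≡ y
  to-injective π {x} {y} eq = trans (sym (from-to π x)) (trans (cong (from π) eq) (from-to π y))

  from-≡ : ∀ {n} (π : Perm P n) {x y} → to π y ≡ x → from π x ≡ y
  from-≡ π {x} {y} eq = trans (cong (from π) (sym eq)) (from-to π y)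

  perm-inv-cong : ∀ {n} (π ρ : Perm P n) → (∀ x → to π x ≡ to ρ x) → ∀ x → from π x ≡ from ρ x
  perm-inv-cong π ρ eq x = from-≡ π (trans (eq _) (to-from ρ x))

  AutEq-comp : ∀ {α α′ β β′} → AutEq P α α′ → AutEq P β β′ → AutEq P (autComp P α β) (autComp P α′ β′)
  AutEq-comp {α} (p , q , r) (p′ , q′ , r′) =
    (λ v → trans (cong (to (πV α)) (p′ v)) (p _)) ,
    (λ e → trans (cong (to (πE α)) (q′ e)) (q _)) ,
    (λ f → trans (cong (to (πF α)) (r′ f)) (r _))

  AutEq-inv : ∀ {α α′} → AutEq P α α′ → AutEq P (autInv P α) (autInv P α′)
  AutEq-inv {α} {α′} (p , q , r) =
    perm-inv-cong (πV α) (πV α′) p , perm-inv-cong (πE α) (πE α′) q , perm-inv-cong (πF α) (πF α′) r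

  pow-V : ∀ s₁ s₂ w n v → to (πV (eval P s₁ s₂ (powℕ w n))) v ≡ iter (to (πV (eval P s₁ s₂ w))) n v
  pow-V s₁ s₂ w zero    v = refl
  pow-V s₁ s₂ w (suc n) v = cong (to (πV (eval P s₁ s₂ w))) (pow-V s₁ s₂ w n v)

  pow-F : ∀ s₁ s₂ w n f → to (πF (eval P s₁ s₂ (powℕ w n))) f ≡ iter (to (πF (eval P s₁ s₂ w))) n f
  pow-F s₁ s₂ w zero    f = refl
  pow-F s₁ s₂ w (suc n) f = cong (to (πF (eval P s₁ s₂ w))) (pow-F s₁ s₂ w n f)

iter-fixed : ∀ {X : Set} (g : X → X) {x} → g x ≡ x → ∀ n → iter g n x ≡ x
iter-fixed g eq zero    = refl
iter-fixed g eq (suc n) = trans (cong g (iter-fixed g eq n)) eq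

-- Rotations of a flat map: rigidity, chirality and the automorphism group.

module _ (M : FlatMap) where
  open FlatMap M

  -- The input for a concrete flat map. The base flag is `v₀`, `e₀`, `f₀`, and `e₁` is the second
  -- edge at `v₀` and `f₀`; `s₁` turns about the base face and `s₂` about the base vertex.
  record Rotary : Set where
    field
      s₁ s₂ : Aut incidence

    V₁ : Fin nV → Fin nV
    V₁ = to (πV s₁)
    V₂ : Fin nV → Fin nV
    V₂ = to (πV s₂)
    E₁ : Fin nE → Fin nE
    E₁ = to (πE s₁)
    E₂ : Fin nE → Fin nE
    E₂ = to (πE s₂)
    F₁ : Fin nF → Fin nF
    F₁ = to (πF s₁)
    F₂ : Fin nF → Fin nF
    F₂ = to (πF s₂)
    e₀ : Fin nE
    e₀ = edgeOf true v₀ f₀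
    e₁ : Fin nE
    e₁ = edgeOf false v₀ f₀

    field
      colour₁ : ∀ {v e f} → At v f e → colour (V₁ v) (E₁ e) (F₁ f) ≡ colour v e f
      colour₂ : ∀ {v e f} → At v f e → colour (V₂ v) (E₂ e) (F₂ f) ≡ colour v e f
      s₁-f₀ : F₁ f₀ ≡ f₀
      s₂-v₀ : V₂ v₀ ≡ v₀
      s₁-v₀ : V₁ v₀ ≢ v₀
      s₂-f₀ : F₂ f₀ ≢ f₀
      s₁-e₀ : E₁ e₀ ≡ e₁
      s₂-e₁ : E₂ e₁ ≡ e₀
      vertex-orbit : ∀ v → ∃ λ n → iter V₁ n v₀ ≡ v
      face-orbit   : ∀ f → ∃ λ n → iter F₂ n f₀ ≡ f
      edge-determined : ∀ d e → (∀ v → VE v d ≡ true → VE v e ≡ true) →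
                        (∀ f → EF d f ≡ true → EF e f ≡ true) → d ≡ e
      -- The premises describe an automorphism that reverses the walk around the base face and the
      -- walk around the base vertex, as a swap of `e₀` and `e₁` would.
      no-reflection : ∀ (γ : Aut incidence) →
        (∀ n → to (πV γ) (iter V₁ n v₀) ≡ iter (from (πV s₁)) n v₀) →
        (∀ n → to (πF γ) (iter F₂ n f₀) ≡ iter (from (πF s₂)) n f₀) → ⊥

    ev : Word → Aut incidence
    ev = eval incidence s₁ s₂

    at₀ : At v₀ f₀ e₀
    at₀ = edgeOf-VE true v₀ f₀ , edgeOf-EF true v₀ f₀

    at₁ : At v₀ f₀ e₁
    at₁ = edgeOf-VE false v₀ f₀ , edgeOf-EF false v₀ f₀

    e₀≢e₁ : e₀ ≢ e₁
    e₀≢e₁ eq with () ← trans (sym (edgeOf-colour true v₀ f₀))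
                         (trans (cong (λ e → colour v₀ e f₀) eq) (edgeOf-colour false v₀ f₀))

    At-act : ∀ (α : Aut incidence) {v f e} → At v f e → At (to (πV α) v) (to (πF α) f) (to (πE α) e)
    At-act α (p , q) = trans (presVE α _ _) p , trans (presEF α _ _) q

    at₀-s₂ : At v₀ (F₂ f₀) e₀
    at₀-s₂ = subst₂ (λ v e → At v (F₂ f₀) e) s₂-v₀ s₂-e₁ (At-act s₂ at₁)

    at₁-s₁ : At (V₁ v₀) f₀ e₁
    at₁-s₁ = subst₂ (λ f e → At (V₁ v₀) f e) s₁-f₀ s₁-e₀ (At-act s₁ at₀)

    s₁⁻¹ s₂⁻¹ : Aut incidence
    s₁⁻¹ = autInv incidence s₁
    s₂⁻¹ = autInv incidence s₂

    s₁⁻¹-f₀ : to (πF s₁⁻¹) f₀ ≡ f₀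
    s₁⁻¹-f₀ = from-≡ incidence (πF s₁) s₁-f₀

    s₂⁻¹-v₀ : to (πV s₂⁻¹) v₀ ≡ v₀
    s₂⁻¹-v₀ = from-≡ incidence (πV s₂) s₂-v₀

    module AroundVertex = Walks (λ e f → At v₀ f e) two-faces′ two-edges′
    module AroundFace = Walks (λ e v → At v f₀ e) two-vertices′ two-edges′

    vertexSymmetry : (α : Aut incidence) → to (πV α) v₀ ≡ v₀ → AroundVertex.Symmetry
    vertexSymmetry α fix = record
      { onX = to (πF α) ; onE = to (πE α)
      ; pres = λ {e} {f} p → subst (λ v → At v (to (πF α) f) (to (πE α) e)) fix (At-act α p)
      ; injX = to-injective incidence (πF α) ; injE = to-injective incidence (πE α) }

    faceSymmetry : (α : Aut incidence) → to (πF α) f₀ ≡ f₀ → AroundFace.Symmetry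
    faceSymmetry α fix = record
      { onX = to (πV α) ; onE = to (πE α)
      ; pres = λ {e} {v} p → subst (λ f → At (to (πV α) v) f (to (πE α) e)) fix (At-act α p)
      ; injX = to-injective incidence (πV α) ; injE = to-injective incidence (πE α) }

    -- Around `v₀` the rotation `s₂` leaves `f₀` across `e₀` and its inverse leaves it across `e₁`;
    -- around `f₀` the rotation `s₁` leaves `v₀` along `e₁` and its inverse along `e₀`. Swapping the
    -- two edges therefore reverses both directions.
    start-s₂ : AroundVertex.Start (vertexSymmetry s₂ s₂-v₀) f₀ e₀
    start-s₂ = record
      { near₀ = at₀ ; far₀ = at₀-s₂ ; x≢ = s₂-f₀
      ; e≢ = λ eq → e₀≢e₁ (to-injective incidence (πE s₂) (trans eq (sym s₂-e₁))) }

    start-s₂⁻¹ : AroundVertex.Start (vertexSymmetry s₂⁻¹ s₂⁻¹-v₀) f₀ e₁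
    start-s₂⁻¹ = record
      { near₀ = at₁
      ; far₀ = subst₂ (λ v e → At v (to (πF s₂⁻¹) f₀) e) s₂⁻¹-v₀ (from-≡ incidence (πE s₂) s₂-e₁) (At-act s₂⁻¹ at₀)
      ; x≢ = λ eq → s₂-f₀ (trans (cong F₂ (sym eq)) (to-from (πF s₂) f₀))
      ; e≢ = λ eq → e₀≢e₁ (trans (sym s₂-e₁) (trans (cong E₂ (sym eq)) (to-from (πE s₂) e₁))) }

    start-s₁ : AroundFace.Start (faceSymmetry s₁ s₁-f₀) v₀ e₁
    start-s₁ = record
      { near₀ = at₁ ; far₀ = at₁-s₁ ; x≢ = s₁-v₀
      ; e≢ = λ eq → e₀≢e₁ (to-injective incidence (πE s₁) (trans s₁-e₀ (sym eq))) }

    start-s₁⁻¹ : AroundFace.Start (faceSymmetry s₁⁻¹ s₁⁻¹-f₀) v₀ e₀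
    start-s₁⁻¹ = record
      { near₀ = at₀
      ; far₀ = subst₂ (λ f e → At (to (πV s₁⁻¹) v₀) f e) s₁⁻¹-f₀ (from-≡ incidence (πE s₁) s₁-e₀) (At-act s₁⁻¹ at₁)
      ; x≢ = λ eq → s₁-v₀ (trans (cong V₁ (sym eq)) (to-from (πV s₁) v₀))
      ; e≢ = λ eq → e₀≢e₁ (trans (sym (to-from (πE s₁) e₀)) (trans (cong E₁ eq) s₁-e₀)) }

    fixes-or-swaps : ∀ (γ : Aut incidence) → to (πV γ) v₀ ≡ v₀ → to (πF γ) f₀ ≡ f₀ →
      (to (πE γ) e₀ ≡ e₀ × to (πE γ) e₁ ≡ e₁) ⊎ (to (πE γ) e₀ ≡ e₁ × to (πE γ) e₁ ≡ e₀)
    fixes-or-swaps γ fv ff = cases (colour v₀ (to (πE γ) e₀) f₀) refl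
      where
      image : ∀ {e} → At v₀ f₀ e → At v₀ f₀ (to (πE γ) e)
      image {e} p = subst₂ (λ v f → At v f (to (πE γ) e)) fv ff (At-act γ p)
      γe₁≢ : ∀ {e} → to (πE γ) e₀ ≡ e → to (πE γ) e₁ ≢ e
      γe₁≢ γe₀ eq = e₀≢e₁ (to-injective incidence (πE γ) (trans γe₀ (sym eq)))
      cases : ∀ c → colour v₀ (to (πE γ) e₀) f₀ ≡ c →
        (to (πE γ) e₀ ≡ e₀ × to (πE γ) e₁ ≡ e₁) ⊎ (to (πE γ) e₀ ≡ e₁ × to (πE γ) e₁ ≡ e₀)
      cases true eq = inj₁ (γe₀ , two-edges′ at₀ (image at₁) at₁ (γe₁≢ γe₀) (λ eq → e₀≢e₁ (sym eq)))
        where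
        γe₀ : to (πE γ) e₀ ≡ e₀
        γe₀ = edge-unique (image at₀) at₀ (trans eq (sym (edgeOf-colour true v₀ f₀)))
      cases false eq = inj₂ (γe₀ , two-edges′ at₁ (image at₁) at₀ (γe₁≢ γe₀) e₀≢e₁)
        where
        γe₀ : to (πE γ) e₀ ≡ e₁
        γe₀ = edge-unique (image at₀) at₁ (trans eq (sym (edgeOf-colour false v₀ f₀)))

    rigid : ∀ (γ : Aut incidence) → to (πV γ) v₀ ≡ v₀ → to (πF γ) f₀ ≡ f₀ →
      AutEq incidence γ (autId incidence)
    rigid γ fv ff with fixes-or-swaps γ fv ff
    ... | inj₂ (γe₀ , γe₁) = ⊥-elim (no-reflection γ
            (AroundFace.symmetry-on-orbit (faceSymmetry γ ff) _ _ start-s₁ start-s₁⁻¹ fv γe₁)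
            (AroundVertex.symmetry-on-orbit (vertexSymmetry γ fv) _ _ start-s₂ start-s₂⁻¹ ff γe₀))
    ... | inj₁ (γe₀ , γe₁) = fixV , fixE , fixF
      where
      fixV : ∀ v → to (πV γ) v ≡ v
      fixV v with n , refl ← vertex-orbit v =
        AroundFace.symmetry-on-orbit (faceSymmetry γ ff) _ _ start-s₁ start-s₁ fv γe₁ n
      fixF : ∀ f → to (πF γ) f ≡ f
      fixF f with n , refl ← face-orbit f =
        AroundVertex.symmetry-on-orbit (vertexSymmetry γ fv) _ _ start-s₂ start-s₂ ff γe₀ n
      fixE : ∀ e → to (πE γ) e ≡ e
      fixE e = sym (edge-determined e (to (πE γ) e)
        (λ v p → subst (λ w → VE w (to (πE γ) e) ≡ true) (fixV v) (trans (presVE γ v e) p))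
        (λ f p → subst (λ g → EF (to (πE γ) e) g ≡ true) (fixF f) (trans (presEF γ e f) p)))

    -- The inverse of `β` composed with `α` fixes `v₀` and `f₀`, so rigidity applies to it.
    rigid₂ : ∀ (α β : Aut incidence) → to (πV α) v₀ ≡ to (πV β) v₀ → to (πF α) f₀ ≡ to (πF β) f₀ →
      AutEq incidence α β
    rigid₂ α β pv pf with rigid (autComp incidence (autInv incidence β) α)
                            (from-≡ incidence (πV β) (sym pv)) (from-≡ incidence (πF β) (sym pf))
    ... | p , q , r = (λ v → undo (πV β) (p v)) , (λ e → undo (πE β) (q e)) , (λ f → undo (πF β) (r f))
      where
      undo : ∀ {n} (π : Perm incidence n) {x y} → from π x ≡ y → x ≡ to π y
      undo π {x} eq = trans (sym (to-from π x)) (cong (to π) eq)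

    -- The walk of `s₂` is a path in the link; it meets every face by transitivity, and each edge at
    -- `v₀` borders one of them.
    vertex-link₀ : ConnectedOn incidence (Inc incidence (inj₁ v₀))
    vertex-link₀ = connected-via incidence (inj₂ (inj₂ f₀)) paths
      where
      open AroundVertex using (Walk; orbit-walk)
      W : Walk (λ n → iter F₂ n f₀) (λ n → iter E₂ n e₀)
      W = orbit-walk _ start-s₂
      open Walk W using (near; far)
      along : ∀ n → Path incidence (Inc incidence (inj₁ v₀)) (inj₂ (inj₂ f₀)) (inj₂ (inj₂ (iter F₂ n f₀)))
      along zero    = here refl
      along (suc n) = step (step {z = inj₂ (inj₁ (iter E₂ n e₀))} (along n) (proj₂ (near n)) (proj₁ (near n)))
                           (proj₂ (far n)) refl
      to-face : ∀ f → Path incidence (Inc incidence (inj₁ v₀)) (inj₂ (inj₂ f₀)) (inj₂ (inj₂ f))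
      to-face f with n , refl ← face-orbit f = along n
      paths : ∀ y → Inc incidence (inj₁ v₀) y → Path incidence (Inc incidence (inj₁ v₀)) (inj₂ (inj₂ f₀)) y
      paths (inj₂ (inj₁ e)) i with f , ef , _ ← faceOf v₀ e true = step (to-face f) ef i
      paths (inj₂ (inj₂ f)) i = to-face f

    face-link₀ : ConnectedOn incidence (Inc incidence (inj₂ (inj₂ f₀)))
    face-link₀ = connected-via incidence (inj₁ v₀) paths
      where
      open AroundFace using (Walk; orbit-walk)
      W : Walk (λ n → iter V₁ n v₀) (λ n → iter E₁ n e₁)
      W = orbit-walk _ start-s₁
      open Walk W using (near; far)
      along : ∀ n → Path incidence (Inc incidence (inj₂ (inj₂ f₀))) (inj₁ v₀) (inj₁ (iter V₁ n v₀))
      along zero    = here refl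
      along (suc n) = step (step {z = inj₂ (inj₁ (iter E₁ n e₁))} (along n) (proj₁ (near n)) (proj₂ (near n)))
                           (proj₁ (far n)) refl
      to-vertex : ∀ v → Path incidence (Inc incidence (inj₂ (inj₂ f₀))) (inj₁ v₀) (inj₁ v)
      to-vertex v with n , refl ← vertex-orbit v = along n
      paths : ∀ y → Inc incidence (inj₂ (inj₂ f₀)) y → Path incidence (Inc incidence (inj₂ (inj₂ f₀))) (inj₁ v₀) y
      paths (inj₁ v)        i = to-vertex v
      paths (inj₂ (inj₁ e)) i with v , ve , _ ← vertexOf e f₀ true = step (to-vertex v) ve i

    pow₁-v₀ : ∀ n → to (πV (ev (powℕ σ₁ n))) v₀ ≡ iter V₁ n v₀
    pow₁-v₀ n = pow-V incidence s₁ s₂ σ₁ n v₀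

    pow₂-f₀ : ∀ n → to (πF (ev (powℕ σ₂ n))) f₀ ≡ iter F₂ n f₀
    pow₂-f₀ n = pow-F incidence s₁ s₂ σ₂ n f₀

    pow₂-v₀ : ∀ n → to (πV (ev (powℕ σ₂ n))) v₀ ≡ v₀
    pow₂-v₀ n = trans (pow-V incidence s₁ s₂ σ₂ n v₀) (iter-fixed V₂ s₂-v₀ n)

    isPolyhedron : IsPolyhedron incidence
    isPolyhedron = record
      { edge-two-vertices = two-vertices
      ; edge-two-faces    = two-faces
      ; diamond           = λ v f _ → two-edges v f
      ; connected         = connected′
      ; vertex-connected  = vertex-conn
      ; face-connected    = face-conn }
      where
      vertex-conn : ∀ v → ConnectedOn incidence (Inc incidence (inj₁ v))
      vertex-conn v with n , eq ← vertex-orbit v =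
        subst (λ w → ConnectedOn incidence (Inc incidence (inj₁ w))) (trans (pow₁-v₀ n) eq)
          (link-connected-image incidence (ev (powℕ σ₁ n)) (inj₁ v₀) vertex-link₀)
      face-conn : ∀ f → ConnectedOn incidence (Inc incidence (inj₂ (inj₂ f)))
      face-conn f with n , eq ← face-orbit f =
        subst (λ g → ConnectedOn incidence (Inc incidence (inj₂ (inj₂ g)))) (trans (pow₂-f₀ n) eq)
          (link-connected-image incidence (ev (powℕ σ₂ n)) (inj₂ (inj₂ f₀)) face-link₀)

    -- Powers of `σ₂` fix `v₀`, so the vertex is placed by a power of `σ₁` alone; the face, pulled
    -- back by that power, is adjusted beforehand by `σ₂`.
    reach : ∀ v f → ∃ λ w → to (πV (ev w)) v₀ ≡ v × to (πF (ev w)) f₀ ≡ f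
    reach v f with i , eqv ← vertex-orbit v
      with j , eqf ← face-orbit (from (πF (ev (powℕ σ₁ i))) f) =
      powℕ σ₁ i · powℕ σ₂ j ,
      trans (cong (to (πV (ev (powℕ σ₁ i)))) (pow₂-v₀ j)) (trans (pow₁-v₀ i) eqv) ,
      trans (cong (to (πF (ev (powℕ σ₁ i)))) (trans (pow₂-f₀ j) eqf)) (to-from (πF (ev (powℕ σ₁ i))) f)

    colour-word : ∀ w {v e f} → At v f e →
      colour (to (πV (ev w)) v) (to (πE (ev w)) e) (to (πF (ev w)) f) ≡ colour v e f
    colour-word σ₁      at = colour₁ at
    colour-word σ₂      at = colour₂ at
    colour-word ε       at = refl
    colour-word (w · u) at = trans (colour-word w (At-act (ev u) at)) (colour-word u at)
    colour-word (inv w) {v} {e} {f} at =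
      trans (sym (colour-word w (At-act (ev (inv w)) at)))
        (trans (cong₂ (λ x y → colour x y _) (to-from (πV (ev w)) v) (to-from (πE (ev w)) e))
               (cong (colour v e) (to-from (πF (ev w)) f)))

    -- The classes are the colours. Rotations carry any vertex and face to any other such pair, and
    -- the colour then determines the edge. An automorphism taking the base flag to the flag with
    -- `e₁` in place of `e₀` would fix `v₀` and `f₀`, hence be the identity.
    isChiral : Chiral incidence
    isChiral = c , alternates , transitive , not-transitive
      where
      c : Flag incidence → Bool
      c Φ = colour (fv Φ) (fe Φ) (ff Φ)
      alternates : ∀ i Φ Ψ → Adj incidence i Φ Ψ → c Φ ≢ c Ψ
      alternates zero (flag v e f ve ef _) (flag w .e .f ve′ _ _) (v≢ , refl , refl) eq =
        v≢ (colour-vertex e f ve ve′ eq)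
      alternates (suc zero) (flag v e f ve ef _) (flag .v d .f ve′ ef′ _) (refl , e≢ , refl) eq =
        e≢ (edge-unique (ve , ef) (ve′ , ef′) eq)
      alternates (suc (suc zero)) (flag v e f ve ef _) (flag .v .e g _ ef′ _) (refl , refl , f≢) eq =
        f≢ (colour-face v e ef ef′ eq)
      transitive : ∀ Φ Ψ → c Φ ≡ c Ψ → Σ (Aut incidence) λ α → SameFlag incidence (act incidence α Φ) Ψ
      transitive (flag v e f ve ef _) (flag v′ e′ f′ ve′ ef′ _) eq
        with w , wv , wf ← reach v f | u , uv , uf ← reach v′ f′ =
        ev (u · inv w) , eqv , edge-unique image (ve′ , ef′)
            (trans (sym (cong₂ (λ x y → colour x _ y) eqv eqf)) (trans (colour-word (u · inv w) (ve , ef)) eq))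
          , eqf
        where
        eqv : to (πV (ev (u · inv w))) v ≡ v′
        eqv = trans (cong (to (πV (ev u))) (from-≡ incidence (πV (ev w)) wv)) uv
        eqf : to (πF (ev (u · inv w))) f ≡ f′
        eqf = trans (cong (to (πF (ev u))) (from-≡ incidence (πF (ev w)) wf)) uf
        image : At v′ f′ (to (πE (ev (u · inv w))) e)
        image = subst₂ (λ x y → At x y (to (πE (ev (u · inv w))) e)) eqv eqf (At-act (ev (u · inv w)) (ve , ef))
      not-transitive : ¬ (∀ Φ Ψ → Σ (Aut incidence) λ α → SameFlag incidence (act incidence α Φ) Ψ)
      not-transitive all
        with γ , γv , γe , γf ← all (flag v₀ e₀ f₀ (proj₁ at₀) (proj₂ at₀) refl)
                                    (flag v₀ e₁ f₀ (proj₁ at₁) (proj₂ at₁) refl) =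
        e₀≢e₁ (trans (sym (proj₁ (proj₂ (rigid γ γv γf)) e₀)) γe)

    AgreeAtBase : Word → Word → Set
    AgreeAtBase w u = to (πV (ev w)) v₀ ≡ to (πV (ev u)) v₀ × to (πF (ev w)) f₀ ≡ to (πF (ev u)) f₀

    -- By rigidity a relation has to be tested at one vertex and one face only.
    isAutGroup : ∀ j₁ i₂ j₂ →
      (∀ n → iter V₁ n v₀ ≡ v₀ → ∃ λ k → n ≡ k * nV) →
      (∀ n → iter F₂ n f₀ ≡ f₀ → ∃ λ k → n ≡ k * nF) →
      AgreeAtBase (powℕ σ₁ nV) ε →
      AgreeAtBase (powℕ σ₂ nF) ε →
      AgreeAtBase (powℕ (σ₁ · σ₂) 2) ε →
      AgreeAtBase (inv σ₂ · σ₁) (powℤ σ₁ (+ 3) · powℤ σ₂ j₁) →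
      AgreeAtBase (σ₂ · inv σ₁) (powℤ σ₁ i₂ · powℤ σ₂ j₂) →
      IsAutGroupOf incidence nV nF (+ 3) j₁ i₂ j₂
    isAutGroup j₁ i₂ j₂ order₁ order₂ r₁ r₂ r₃ r₄ r₅ =
      flag v₀ e₀ f₀ (proj₁ at₀) (proj₂ at₀) refl , s₁ , s₂ ,
      -- The adjacent flags are read off from two facts: `e₁` joins `v₀` to `V₁ v₀` on the face
      -- `f₀`, and `e₀` separates `f₀` from `F₂ f₀` at the vertex `v₀`.
      ( flag v₀ e₁ f₀ (proj₁ at₁) (proj₂ at₁) refl
      , flag (V₁ v₀) e₁ f₀ (proj₁ at₁-s₁) (proj₂ at₁-s₁) refl
      , (refl , e₀≢e₁ , refl) , ((λ eq → s₁-v₀ (sym eq)) , refl , refl) , (refl , s₁-e₀ , s₁-f₀)) ,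
      ( flag v₀ e₀ (F₂ f₀) (proj₁ at₀-s₂) (proj₂ at₀-s₂) refl
      , flag v₀ (E₂ e₀) (F₂ f₀) (subst (λ v → VE v (E₂ e₀) ≡ true) s₂-v₀ (proj₁ (At-act s₂ at₀)))
          (proj₂ (At-act s₂ at₀)) refl
      , (refl , refl , (λ eq → s₂-f₀ (sym eq)))
      , (refl , (λ eq → AroundVertex.Start.e≢ start-s₂ (sym eq)) , refl) , (s₂-v₀ , refl , refl)) ,
      sound , complete , surjective
      where
      nonZero : ∀ {n} → Fin n → NonZero n
      nonZero {suc n} _ = _
      instance
        nV≢0 : NonZero nV
        nV≢0 = nonZero v₀
        nF≢0 : NonZero nF
        nF≢0 = nonZero f₀
      open NormalForm nV nF j₁ i₂ j₂

      base : ∀ w u → AgreeAtBase w u → AutEq incidence (ev w) (ev u)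
      base w u (p , q) = rigid₂ (ev w) (ev u) p q

      sound : ∀ w u → w ~ u → AutEq incidence (ev w) (ev u)
      sound w .w rfl = (λ _ → refl) , (λ _ → refl) , (λ _ → refl)
      sound w u (sy r) = AutEq-sym incidence {ev u} {ev w} (sound u w r)
      sound w u (tr {u = t} r s) = AutEq-trans incidence {ev w} {ev t} {ev u} (sound w t r) (sound t u s)
      sound (w · u) (w′ · u′) (·-cong r s) =
        AutEq-comp incidence {ev w} {ev w′} {ev u} {ev u′} (sound w w′ r) (sound u u′ s)
      sound (inv w) (inv u) (inv-cong r) = AutEq-inv incidence {ev w} {ev u} (sound w u r)
      sound _ _ assoc = (λ _ → refl) , (λ _ → refl) , (λ _ → refl)
      sound _ _ idˡ = (λ _ → refl) , (λ _ → refl) , (λ _ → refl)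
      sound _ _ idʳ = (λ _ → refl) , (λ _ → refl) , (λ _ → refl)
      sound _ _ (invˡ {w}) = from-to (πV (ev w)) , from-to (πE (ev w)) , from-to (πF (ev w))
      sound _ _ (invʳ {w}) = to-from (πV (ev w)) , to-from (πE (ev w)) , to-from (πF (ev w))
      sound w u rel₁ = base w u r₁
      sound w u rel₂ = base w u r₂
      sound w u rel₃ = base w u r₃
      sound w u rel₄ = base w u r₄
      sound w u rel₅ = base w u r₅

      -- In the normal form the power of `σ₂` fixes `v₀`, so the image of the vertex determines `i`
      -- modulo `nV`. Once the power of `σ₁` is trivial, the image of the face determines `j` modulo
      -- `nF`.
      trivial : ∀ x → to (πV (ev x)) v₀ ≡ v₀ → to (πF (ev x)) f₀ ≡ f₀ → x ~ ε
      trivial x xv xf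
        with i , j , r ← normalForm x
        with i′ , eqi ← order₁ i (trans (sym (pow₁-v₀ i))
               (trans (cong (to (πV (ev (powℕ σ₁ i)))) (sym (pow₂-v₀ j)))
                 (trans (sym (proj₁ (sound _ _ r) v₀)) xv)))
        with a^i ← subst (λ n → powℕ σ₁ n ~ ε) (sym eqi) (pow-multiple rel₁ i′)
        with j′ , eqj ← order₂ j (trans (sym (pow₂-f₀ j))
               (trans (sym (proj₂ (proj₂ (sound _ _ a^i)) _))
                 (trans (sym (proj₂ (proj₂ (sound _ _ r)) f₀)) xf)))
        = tr r (tr (·-cong a^i (subst (λ n → powℕ σ₂ n ~ ε) (sym eqj) (pow-multiple rel₂ j′))) idˡ)

      complete : ∀ w u → AutEq incidence (ev w) (ev u) → w ~ u
      complete w u (p , _ , q) =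
        tr (sy idˡ) (tr (·-cong (sy invʳ) rfl) (tr assoc (tr (·-cong rfl
          (trivial (inv u · w) (from-≡ incidence (πV (ev u)) (sym (p v₀))) (from-≡ incidence (πF (ev u)) (sym (q f₀)))))
          idʳ)))

      surjective : ∀ α → Σ Word λ w → AutEq incidence α (ev w)
      surjective α with w , p , q ← reach (to (πV α) v₀) (to (πF α) f₀) =
        w , rigid₂ α (ev w) (sym p) (sym q)

-- Integers modulo n.

module Mod (n : ℕ) .{{_ : NonZero n}} where

  Multiple : ℤ → Set
  Multiple d = ∃ λ q → d ≡ q *ℤ + n

  multiple-+ : ∀ {d e} → Multiple d → Multiple e → Multiple (d +ℤ e)
  multiple-+ (q , refl) (r , refl) = q +ℤ r , sym (ℤₚ.*-distribʳ-+ (+ n) q r)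

  multiple-* : ∀ c {d} → Multiple d → Multiple (c *ℤ d)
  multiple-* c (q , refl) = c *ℤ q , sym (ℤₚ.*-assoc c q (+ n))

  infix 4 _≈_
  -- A record instead of an abbreviation for `Multiple (x -ℤ y)`, so that unification can recover
  -- `x` and `y` from a congruence.
  record _≈_ (x y : ℤ) : Set where
    constructor mk≈
    field
      quotient : ℤ
      equation : x ≡ y +ℤ quotient *ℤ + n

  ≈-by : ∀ {x y d} → Multiple d → x ≡ y +ℤ d → x ≈ y
  ≈-by (q , refl) eq = mk≈ q eq

  ≈-reflexive : ∀ {x y} → x ≡ y → x ≈ y
  ≈-reflexive {x} refl = mk≈ (+ 0) (sym (ℤₚ.+-identityʳ x))

  ≈-refl : ∀ {x} → x ≈ x
  ≈-refl = ≈-reflexive refl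

  ≈-sym : ∀ {x y} → x ≈ y → y ≈ x
  ≈-sym {y = y} (mk≈ q refl) = mk≈ (- q) (identity y q (+ n))
    where
    identity : ∀ y q n → y ≡ y +ℤ q *ℤ n +ℤ - q *ℤ n
    identity = solve-∀

  ≈-trans : ∀ {x y z} → x ≈ y → y ≈ z → x ≈ z
  ≈-trans {z = z} (mk≈ q refl) (mk≈ r refl) = mk≈ (q +ℤ r) (identity z q r (+ n))
    where
    identity : ∀ z q r n → z +ℤ r *ℤ n +ℤ q *ℤ n ≡ z +ℤ (q +ℤ r) *ℤ n
    identity = solve-∀

  +-cong : ∀ {x y z w} → x ≈ y → z ≈ w → x +ℤ z ≈ y +ℤ w
  +-cong {y = y} {w = w} (mk≈ q refl) (mk≈ r refl) = mk≈ (q +ℤ r) (identity y w q r (+ n))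
    where
    identity : ∀ y w q r n → y +ℤ q *ℤ n +ℤ (w +ℤ r *ℤ n) ≡ y +ℤ w +ℤ (q +ℤ r) *ℤ n
    identity = solve-∀

  *-cong : ∀ {x y z w} → x ≈ y → z ≈ w → x *ℤ z ≈ y *ℤ w
  *-cong {y = y} {w = w} (mk≈ q refl) (mk≈ r refl) = mk≈ (y *ℤ r +ℤ q *ℤ w +ℤ q *ℤ + n *ℤ r) (identity y w q r (+ n))
    where
    identity : ∀ y w q r n → (y +ℤ q *ℤ n) *ℤ (w +ℤ r *ℤ n) ≡ y *ℤ w +ℤ (y *ℤ r +ℤ q *ℤ w +ℤ q *ℤ n *ℤ r) *ℤ n
    identity = solve-∀

  neg-cong : ∀ {x y} → x ≈ y → - x ≈ - y
  neg-cong {y = y} (mk≈ q refl) = mk≈ (- q) (identity y q (+ n))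
    where
    identity : ∀ y q n → - (y +ℤ q *ℤ n) ≡ - y +ℤ - q *ℤ n
    identity = solve-∀

  minus-cong : ∀ {x y z w} → x ≈ y → z ≈ w → x -ℤ z ≈ y -ℤ w
  minus-cong p q = +-cong p (neg-cong q)

  ≈⇒multiple : ∀ {x y} → x ≈ y → Multiple (x -ℤ y)
  ≈⇒multiple {y = y} (mk≈ q refl) = q , identity y q (+ n)
    where
    identity : ∀ y q n → y +ℤ q *ℤ n -ℤ y ≡ q *ℤ n
    identity = solve-∀

  ι : Fin n → ℤ
  ι x = + toℕ x

  opaque
    -- Opaque, so that residues are handled through `ι-⟦⟧` and integer division is not unfolded.
    ⟦_⟧ : ℤ → Fin n
    ⟦ z ⟧ = fromℕ< (n%ℕd<d z n)

    ι-⟦⟧ : ∀ z → ι ⟦ z ⟧ ≈ z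
    ι-⟦⟧ z = ≈-sym (mk≈ (z /ℕ n)
      (trans (a≡a%ℕn+[a/ℕn]*n z n) (cong (λ r → + r +ℤ (z /ℕ n) *ℤ + n) (sym (toℕ-fromℕ< (n%ℕd<d z n))))))

  ι-injective : ∀ {x y} → ι x ≈ ι y → x ≡ y
  ι-injective {x} {y} (mk≈ q eq) = by-sign q eq
    where
    reduced : ∀ {x y : Fin n} k → ι x ≡ ι y +ℤ + k *ℤ + n → x ≡ y
    reduced {x} {y} k eq = toℕ-injective (begin
      toℕ x                    ≡⟨ sym (m<n⇒m%n≡m (toℕ<n x)) ⟩
      toℕ x % n                ≡⟨ cong (_% n) (ℤₚ.+-injective (trans eq (cong (λ z → ι y +ℤ z) (sym (ℤₚ.pos-* k n))))) ⟩
      (toℕ y + k * n) % n      ≡⟨ [m+kn]%n≡m%n (toℕ y) k n ⟩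
      toℕ y % n                ≡⟨ m<n⇒m%n≡m (toℕ<n y) ⟩
      toℕ y                    ∎)
      where open ≡-Reasoning
    by-sign : ∀ q → ι x ≡ ι y +ℤ q *ℤ + n → x ≡ y
    by-sign (+ k)    eq = reduced k eq
    -- A negative quotient moves to the other side of the equation and becomes a natural one.
    by-sign -[1+ k ] eq = sym (reduced (suc k)
      (trans (_≈_.equation (≈-sym (mk≈ {ι y +ℤ -[1+ k ] *ℤ + n} {ι y} -[1+ k ] refl)))
             (cong (λ z → z +ℤ + suc k *ℤ + n) (sym eq))))

  ⟦⟧-cong : ∀ {x y} → x ≈ y → ⟦ x ⟧ ≡ ⟦ y ⟧
  ⟦⟧-cong {x} {y} p = ι-injective (≈-trans (ι-⟦⟧ x) (≈-trans p (≈-sym (ι-⟦⟧ y))))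

  ⟦⟧-injective : ∀ {x y} → ⟦ x ⟧ ≡ ⟦ y ⟧ → x ≈ y
  ⟦⟧-injective {x} {y} eq = ≈-trans (≈-sym (ι-⟦⟧ x)) (≈-trans (≈-reflexive (cong ι eq)) (ι-⟦⟧ y))

  ⟦ι⟧ : ∀ x → ⟦ ι x ⟧ ≡ x
  ⟦ι⟧ x = ι-injective (ι-⟦⟧ (ι x))

  representative : ∀ (x : Fin n) → ∃ λ z → x ≡ ⟦ z ⟧
  representative x = ι x , sym (⟦ι⟧ x)

  multiple-ℕ : ∀ {k} → + k ≈ + 0 → ∃ λ q → k ≡ q * n
  multiple-ℕ {k} (mk≈ q eq) = ∣ q ∣ , trans (cong ∣_∣ (trans eq (ℤₚ.+-identityˡ (q *ℤ + n)))) (ℤₚ.abs-* q (+ n))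

  ⟦n⟧ : ⟦ + n ⟧ ≡ ⟦ + 0 ⟧
  ⟦n⟧ = ⟦⟧-cong {+ n} {+ 0} (mk≈ (+ 1) (sym (trans (ℤₚ.+-identityˡ _) (ℤₚ.*-identityˡ (+ n)))))

-- Boolean equality and parity.

infix 5 _==_
_==_ : ∀ {n} → Fin n → Fin n → Bool
x == y = does (x ≟ y)

==-complete : ∀ {n} {x y : Fin n} → x ≡ y → (x == y) ≡ true
==-complete {x = x} refl = dec-true (x ≟ x) refl

==-sound : ∀ {n} {x y : Fin n} → (x == y) ≡ true → x ≡ y
==-sound {x = x} {y} eq with x ≟ y
... | yes p = p

==-false : ∀ {n} {x y : Fin n} → x ≢ y → (x == y) ≡ false
==-false {x = x} {y} ne = dec-false (x ≟ y) ne

==-injection : ∀ {n k} (g : Fin n → Fin k) → (∀ {x y} → g x ≡ g y → x ≡ y) →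
  ∀ x y → (g x == g y) ≡ (x == y)
==-injection g inj x y with x ≟ y
... | yes refl = ==-complete {x = g x} refl
... | no ne    = ==-false (λ eq → ne (inj eq))

one-odd : ∀ w → + 1 ≢ + 2 *ℤ w
one-odd w eq with () ← ℕₚ.m*n≡1⇒m≡1 2 ∣ w ∣ (sym (trans (cong ∣_∣ eq) (ℤₚ.abs-* (+ 2) w)))

consecutive-even : ∀ z → ∃ λ t → z *ℤ (z -ℤ + 1) ≡ + 2 *ℤ t
consecutive-even z with z %ℕ 2 | z /ℕ 2 | n%ℕd<d z 2 | a≡a%ℕn+[a/ℕn]*n z 2
... | 0 | q | _ | refl = q *ℤ (q *ℤ + 2 -ℤ + 1) , identity q
  where
  identity : ∀ q → (+ 0 +ℤ q *ℤ + 2) *ℤ (+ 0 +ℤ q *ℤ + 2 -ℤ + 1) ≡ + 2 *ℤ (q *ℤ (q *ℤ + 2 -ℤ + 1))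
  identity = solve-∀
... | 1 | q | _ | refl = q *ℤ (q *ℤ + 2 +ℤ + 1) , identity q
  where
  identity : ∀ q → (+ 1 +ℤ q *ℤ + 2) *ℤ (+ 1 +ℤ q *ℤ + 2 -ℤ + 1) ≡ + 2 *ℤ (q *ℤ (q *ℤ + 2 +ℤ + 1))
  identity = solve-∀
... | suc (suc _) | q | s≤s (s≤s ()) | _

-- Arithmetic of the twist u modulo m and N.

-- Satisfied by m = 2^(α−1), N = 2^β and u = ±2^(β−3).
record Conditions (m N : ℕ) (u : ℤ) : Set where
  field
    N∣8u    : ∃ λ q → + 8 *ℤ u ≡ q *ℤ + N
    N∣2u²   : ∃ λ q → + 2 *ℤ (u *ℤ u) ≡ q *ℤ + N
    N∣u³    : ∃ λ q → u *ℤ u *ℤ u ≡ q *ℤ + N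
    N∤4u    : ∀ q → + 4 *ℤ u ≢ q *ℤ + N
    m∣2u    : ∃ λ q → + 2 *ℤ u ≡ q *ℤ + m
    m∣N     : ∃ λ q → + N ≡ q *ℤ + m
    4∣m     : ∃ λ q → + m ≡ q *ℤ + 4

module Arithmetic (m N : ℕ) {{m≢0 : NonZero m}} {{N≢0 : NonZero N}} (u : ℤ) (conditions : Conditions m N u) where
  open Conditions conditions
  module 𝕍 = Mod m
  module 𝔽 = Mod N
  open 𝕍 using () renaming (_≈_ to _≈ₘ_)
  open 𝔽 using (_≈_)

  -- As m divides N, a face label may be added to a vertex index; the odd vertex 2k-1-2j of an edge
  -- requires this.
  reduce : ∀ {x y} → x ≈ y → x ≈ₘ y
  reduce {x} {y} p with q , eq ← 𝔽.≈⇒multiple p | r , eqN ← m∣N =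
    𝕍.≈-by {d = x -ℤ y} (q *ℤ r , trans eq (trans (cong (q *ℤ_) eqN) (sym (ℤₚ.*-assoc q r (+ m))))) (identity x y)
    where
    identity : ∀ x y → x ≡ y +ℤ (x -ℤ y)
    identity = solve-∀

  -- Moving `x` by m, a multiple of 4, moves 2ux by a multiple of 8u. Hence the second face j+1-2uk
  -- is well defined for k modulo m.
  2u*-cong : ∀ {x y} → x ≈ₘ y → + 2 *ℤ u *ℤ x ≈ + 2 *ℤ u *ℤ y
  2u*-cong {x} {y} p with q , eq ← 𝕍.≈⇒multiple p | r , eqm ← 4∣m =
    𝔽.≈-by {d = q *ℤ r *ℤ (+ 8 *ℤ u)} (𝔽.multiple-* (q *ℤ r) N∣8u)
      (trans (identity u x y) (cong (λ z → + 2 *ℤ u *ℤ y +ℤ z)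
        (trans (cong (λ z → + 2 *ℤ u *ℤ z) (trans eq (cong (q *ℤ_) eqm))) (identity₂ u q r))))
    where
    identity : ∀ u x y → + 2 *ℤ u *ℤ x ≡ + 2 *ℤ u *ℤ y +ℤ + 2 *ℤ u *ℤ (x -ℤ y)
    identity = solve-∀
    identity₂ : ∀ u q r → + 2 *ℤ u *ℤ (q *ℤ (r *ℤ + 4)) ≡ q *ℤ r *ℤ (+ 8 *ℤ u)
    identity₂ = solve-∀

  -- This rests on m dividing 2u, which comes from β ≥ α+1: the twist moves faces but disappears on
  -- vertex indices.
  2u*≈ₘ0 : ∀ x → + 2 *ℤ u *ℤ x ≈ₘ + 0
  2u*≈ₘ0 x = 𝕍.≈-by {d = x *ℤ (+ 2 *ℤ u)} (𝕍.multiple-* x m∣2u) (identity u x)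
    where
    identity : ∀ u x → + 2 *ℤ u *ℤ x ≡ + 0 +ℤ x *ℤ (+ 2 *ℤ u)
    identity = solve-∀

  4∣N : ∃ λ q → + N ≡ q *ℤ + 4
  4∣N with q , eq ← m∣N | r , eqm ← 4∣m =
    q *ℤ r , trans eq (trans (cong (q *ℤ_) eqm) (sym (ℤₚ.*-assoc q r (+ 4))))

  odd-not-multiple : ∀ w → ¬ 𝔽.Multiple (+ 1 +ℤ + 2 *ℤ w)
  odd-not-multiple w (q , eq) with r , eqN ← 4∣N =
    one-odd (q *ℤ r *ℤ + 2 -ℤ w) (trans (identity w) (trans (cong (_-ℤ + 2 *ℤ w) (trans eq (cong (q *ℤ_) eqN))) (identity₂ q r w)))
    where
    identity : ∀ w → + 1 ≡ + 1 +ℤ + 2 *ℤ w -ℤ + 2 *ℤ w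
    identity = solve-∀
    identity₂ : ∀ q r w → q *ℤ (r *ℤ + 4) -ℤ + 2 *ℤ w ≡ + 2 *ℤ (q *ℤ r *ℤ + 2 -ℤ w)
    identity₂ = solve-∀

  oddly-even-not-multiple : ∀ w → ¬ 𝔽.Multiple (+ 2 +ℤ + 4 *ℤ w)
  oddly-even-not-multiple w (q , eq) with r , eqN ← 4∣N =
    one-odd (q *ℤ r -ℤ w) (ℤₚ.*-cancelˡ-≡ (+ 2) (+ 1) _
      (trans (identity w) (trans (cong (_-ℤ + 4 *ℤ w) (trans eq (cong (q *ℤ_) eqN))) (identity₂ q r w))))
    where
    identity : ∀ w → + 2 ≡ + 2 +ℤ + 4 *ℤ w -ℤ + 4 *ℤ w
    identity = solve-∀
    identity₂ : ∀ q r w → q *ℤ (r *ℤ + 4) -ℤ + 4 *ℤ w ≡ + 2 *ℤ (+ 2 *ℤ (q *ℤ r -ℤ w))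
    identity₂ = solve-∀

  -- Only 2u² is known to vanish modulo N, and for β = 5 the square u² does not; the missing factor
  -- 2 comes from two consecutive integers.
  u²-even : ∀ z → 𝔽.Multiple (u *ℤ u *ℤ (z *ℤ (z -ℤ + 1)))
  u²-even z with t , eq ← consecutive-even z =
    subst 𝔽.Multiple (trans (identity u t) (cong (u *ℤ u *ℤ_) (sym eq))) (𝔽.multiple-* t N∣2u²)
    where
    identity : ∀ u t → t *ℤ (+ 2 *ℤ (u *ℤ u)) ≡ u *ℤ u *ℤ (+ 2 *ℤ t)
    identity = solve-∀

  -- The shape of the error terms in the identities below: everything beyond first order in u.
  small : ∀ a b → 𝔽.Multiple (a *ℤ (+ 2 *ℤ (u *ℤ u)) +ℤ b *ℤ (u *ℤ u *ℤ u))
  small a b = 𝔽.multiple-+ (𝔽.multiple-* a N∣2u²) (𝔽.multiple-* b N∣u³)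

  -- θ is the action of σ₁ on the faces: σ₁σ₂ʲ⟨σ₁⟩ = σ₂^θ(j)⟨σ₁⟩.
  θ : ℤ → ℤ
  θ z = - z -ℤ u *ℤ (z *ℤ (z -ℤ + 1))

  -- The equation w = θ(z) solved for z to first order in u, by putting -w for z in the quadratic
  -- term.
  θ⁻¹ : ℤ → ℤ
  θ⁻¹ z = - z -ℤ u *ℤ (z *ℤ (z +ℤ + 1))

  θ-cong : ∀ {x y} → x ≈ y → θ x ≈ θ y
  θ-cong p = 𝔽.minus-cong (𝔽.neg-cong p) (𝔽.*-cong (𝔽.≈-refl {u}) (𝔽.*-cong p (𝔽.minus-cong p 𝔽.≈-refl)))

  θ⁻¹-cong : ∀ {x y} → x ≈ y → θ⁻¹ x ≈ θ⁻¹ y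
  θ⁻¹-cong p = 𝔽.minus-cong (𝔽.neg-cong p) (𝔽.*-cong (𝔽.≈-refl {u}) (𝔽.*-cong p (𝔽.+-cong p 𝔽.≈-refl)))

  θ⁻¹-θ : ∀ z → θ⁻¹ (θ z) ≈ z
  θ⁻¹-θ z = 𝔽.≈-by (𝔽.multiple-+ (𝔽.multiple-* (- (+ 2 *ℤ z -ℤ + 1)) (u²-even z))
      (𝔽.multiple-* (- (z *ℤ (z -ℤ + 1) *ℤ (z *ℤ (z -ℤ + 1)))) N∣u³)) (identity u z)
    where
    identity : ∀ u z → - (- z -ℤ u *ℤ (z *ℤ (z -ℤ + 1))) -ℤ
        u *ℤ ((- z -ℤ u *ℤ (z *ℤ (z -ℤ + 1))) *ℤ (- z -ℤ u *ℤ (z *ℤ (z -ℤ + 1)) +ℤ + 1))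
      ≡ z +ℤ (- (+ 2 *ℤ z -ℤ + 1) *ℤ (u *ℤ u *ℤ (z *ℤ (z -ℤ + 1)))
              +ℤ - (z *ℤ (z -ℤ + 1) *ℤ (z *ℤ (z -ℤ + 1))) *ℤ (u *ℤ u *ℤ u))
    identity = solve-∀

  θ-θ⁻¹ : ∀ z → θ (θ⁻¹ z) ≈ z
  θ-θ⁻¹ z = 𝔽.≈-by (𝔽.multiple-+ (𝔽.multiple-* (- (+ 2 *ℤ z +ℤ + 1)) (u²-even (z +ℤ + 1)))
      (𝔽.multiple-* (- (z *ℤ (z +ℤ + 1) *ℤ (z *ℤ (z +ℤ + 1)))) N∣u³)) (identity u z)
    where
    identity : ∀ u z → - (- z -ℤ u *ℤ (z *ℤ (z +ℤ + 1))) -ℤ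
        u *ℤ ((- z -ℤ u *ℤ (z *ℤ (z +ℤ + 1))) *ℤ (- z -ℤ u *ℤ (z *ℤ (z +ℤ + 1)) -ℤ + 1))
      ≡ z +ℤ (- (+ 2 *ℤ z +ℤ + 1) *ℤ (u *ℤ u *ℤ ((z +ℤ + 1) *ℤ (z +ℤ + 1 -ℤ + 1)))
              +ℤ - (z *ℤ (z +ℤ + 1) *ℤ (z *ℤ (z +ℤ + 1))) *ℤ (u *ℤ u *ℤ u))
    identity = solve-∀

  -- The quadratic term is u times an even number, and m divides 2u.
  θ≈ₘ- : ∀ z → θ z ≈ₘ - z
  θ≈ₘ- z with t , eq ← consecutive-even z =
    𝕍.≈-by {d = - t *ℤ (+ 2 *ℤ u)} (𝕍.multiple-* (- t) m∣2u)
      (trans (cong (λ w → - z -ℤ u *ℤ w) eq) (identity u z t))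
    where
    identity : ∀ u z t → - z -ℤ u *ℤ (+ 2 *ℤ t) ≡ - z +ℤ - t *ℤ (+ 2 *ℤ u)
    identity = solve-∀

  -- σ₁ interchanges the roles of the two faces of an edge: the image of (x , z) is (x-z ,
  -- θ(z+1-2ux)) and must have second face θ(z). The term -2u(x-z) is balanced by θ(z+1) - θ(z) = -1
  -- - 2uz.
  θ-other : ∀ x z → θ (z +ℤ + 1 -ℤ + 2 *ℤ u *ℤ x) +ℤ + 1 -ℤ + 2 *ℤ u *ℤ (x -ℤ z) ≈ θ z
  θ-other x z = 𝔽.≈-by (small (x *ℤ (+ 2 *ℤ z +ℤ + 1)) (- (+ 4 *ℤ (x *ℤ x)))) (identity u x z)
    where
    identity : ∀ u x z →
        - (z +ℤ + 1 -ℤ + 2 *ℤ u *ℤ x) -ℤ u *ℤ ((z +ℤ + 1 -ℤ + 2 *ℤ u *ℤ x) *ℤ (z +ℤ + 1 -ℤ + 2 *ℤ u *ℤ x -ℤ + 1))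
          +ℤ + 1 -ℤ + 2 *ℤ u *ℤ (x -ℤ z)
      ≡ - z -ℤ u *ℤ (z *ℤ (z -ℤ + 1))
          +ℤ (x *ℤ (+ 2 *ℤ z +ℤ + 1) *ℤ (+ 2 *ℤ (u *ℤ u)) +ℤ - (+ 4 *ℤ (x *ℤ x)) *ℤ (u *ℤ u *ℤ u))
    identity = solve-∀

  -- The face part of the relation for σ₂⁻¹σ₁: from the face 0, σ₂^(1+2u) leads to 1+2u, and σ₁ then
  -- runs through -1-2u, 1 and -1, the last being the image of 0 under σ₂⁻¹.
  θ³[1+2u] : θ (θ (θ (+ 1 +ℤ + 2 *ℤ u))) ≈ - (+ 1)
  θ³[1+2u] = 𝔽.≈-trans (θ-cong (𝔽.≈-trans (θ-cong first) second)) (𝔽.≈-reflexive (third u))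
    where
    first : θ (+ 1 +ℤ + 2 *ℤ u) ≈ - (+ 1) -ℤ + 2 *ℤ u
    first = 𝔽.≈-by (small (- (+ 1)) (- (+ 4))) (identity u)
      where
      identity : ∀ u → - (+ 1 +ℤ + 2 *ℤ u) -ℤ u *ℤ ((+ 1 +ℤ + 2 *ℤ u) *ℤ (+ 1 +ℤ + 2 *ℤ u -ℤ + 1))
        ≡ - (+ 1) -ℤ + 2 *ℤ u +ℤ (- (+ 1) *ℤ (+ 2 *ℤ (u *ℤ u)) +ℤ - (+ 4) *ℤ (u *ℤ u *ℤ u))
      identity = solve-∀
    second : θ (- (+ 1) -ℤ + 2 *ℤ u) ≈ + 1
    second = 𝔽.≈-by (small (- (+ 3)) (- (+ 4))) (identity u)
      where
      identity : ∀ u → - (- (+ 1) -ℤ + 2 *ℤ u) -ℤ u *ℤ ((- (+ 1) -ℤ + 2 *ℤ u) *ℤ (- (+ 1) -ℤ + 2 *ℤ u -ℤ + 1))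
        ≡ + 1 +ℤ (- (+ 3) *ℤ (+ 2 *ℤ (u *ℤ u)) +ℤ - (+ 4) *ℤ (u *ℤ u *ℤ u))
      identity = solve-∀
    third : ∀ u → - (+ 1) -ℤ u *ℤ (+ 1 *ℤ (+ 1 -ℤ + 1)) ≡ - (+ 1)
    third = solve-∀

  -- The analogue for σ₂σ₁⁻¹: the face -1+2u runs through 1-2u, -1 and 1.
  θ⁻³[-1+2u] : θ⁻¹ (θ⁻¹ (θ⁻¹ (- (+ 1) +ℤ + 2 *ℤ u))) ≈ + 1
  θ⁻³[-1+2u] = 𝔽.≈-trans (θ⁻¹-cong (𝔽.≈-trans (θ⁻¹-cong first) second)) (𝔽.≈-reflexive (third u))
    where
    first : θ⁻¹ (- (+ 1) +ℤ + 2 *ℤ u) ≈ + 1 -ℤ + 2 *ℤ u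
    first = 𝔽.≈-by (small (+ 1) (- (+ 4))) (identity u)
      where
      identity : ∀ u → - (- (+ 1) +ℤ + 2 *ℤ u) -ℤ u *ℤ ((- (+ 1) +ℤ + 2 *ℤ u) *ℤ (- (+ 1) +ℤ + 2 *ℤ u +ℤ + 1))
        ≡ + 1 -ℤ + 2 *ℤ u +ℤ (+ 1 *ℤ (+ 2 *ℤ (u *ℤ u)) +ℤ - (+ 4) *ℤ (u *ℤ u *ℤ u))
      identity = solve-∀
    second : θ⁻¹ (+ 1 -ℤ + 2 *ℤ u) ≈ - (+ 1)
    second = 𝔽.≈-by (small (+ 3) (- (+ 4))) (identity u)
      where
      identity : ∀ u → - (+ 1 -ℤ + 2 *ℤ u) -ℤ u *ℤ ((+ 1 -ℤ + 2 *ℤ u) *ℤ (+ 1 -ℤ + 2 *ℤ u +ℤ + 1))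
        ≡ - (+ 1) +ℤ (+ 3 *ℤ (+ 2 *ℤ (u *ℤ u)) +ℤ - (+ 4) *ℤ (u *ℤ u *ℤ u))
      identity = solve-∀
    third : ∀ u → - (- (+ 1)) -ℤ u *ℤ (- (+ 1) *ℤ (- (+ 1) +ℤ + 1)) ≡ + 1
    third = solve-∀

-- The coset geometry in coordinates.

module Construction (m N : ℕ) {{m≢0 : NonZero m}} {{N≢0 : NonZero N}} (u : ℤ) (conditions : Conditions m N u) where
  open Conditions conditions
  open Arithmetic m N u conditions
  open 𝕍 using () renaming (⟦_⟧ to ⟦_⟧ₘ; ι to ιₘ)
  open 𝔽 using (⟦_⟧; ι)

  -- For the edge `(k , j)`, `other` is the second face and `dif` the index of the odd vertex, since
  -- 2k-1-2j = 2(k-j)-1. `prev` inverts `other` in `j`, and `add` inverts `dif` in `k`.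
  other : Fin m → Fin N → Fin N
  other k j = ⟦ ι j +ℤ + 1 -ℤ + 2 *ℤ u *ℤ ιₘ k ⟧

  prev : Fin m → Fin N → Fin N
  prev k f = ⟦ ι f -ℤ + 1 +ℤ + 2 *ℤ u *ℤ ιₘ k ⟧

  dif : Fin m → Fin N → Fin m
  dif k j = ⟦ ιₘ k -ℤ ι j ⟧ₘ

  add : Fin m → Fin N → Fin m
  add k j = ⟦ ιₘ k +ℤ ι j ⟧ₘ

  shiftₘ : ℤ → Fin m → Fin m
  shiftₘ c k = ⟦ ιₘ k +ℤ c ⟧ₘ

  shift : ℤ → Fin N → Fin N
  shift c j = ⟦ ι j +ℤ c ⟧

  Θ : Fin N → Fin N
  Θ j = ⟦ θ (ι j) ⟧

  Θ⁻¹ : Fin N → Fin N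
  Θ⁻¹ j = ⟦ θ⁻¹ (ι j) ⟧

  -- Independence of representatives, here and in the next rules, reduces identities between
  -- residues to ring identities and congruences over the integers.
  other-⟦⟧ : ∀ x z → other ⟦ x ⟧ₘ ⟦ z ⟧ ≡ ⟦ z +ℤ + 1 -ℤ + 2 *ℤ u *ℤ x ⟧
  other-⟦⟧ x z = 𝔽.⟦⟧-cong (𝔽.minus-cong (𝔽.+-cong (𝔽.ι-⟦⟧ z) 𝔽.≈-refl) (2u*-cong (𝕍.ι-⟦⟧ x)))

  prev-⟦⟧ : ∀ x z → prev ⟦ x ⟧ₘ ⟦ z ⟧ ≡ ⟦ z -ℤ + 1 +ℤ + 2 *ℤ u *ℤ x ⟧
  prev-⟦⟧ x z = 𝔽.⟦⟧-cong (𝔽.+-cong (𝔽.minus-cong (𝔽.ι-⟦⟧ z) 𝔽.≈-refl) (2u*-cong (𝕍.ι-⟦⟧ x)))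

  dif-⟦⟧ : ∀ x z → dif ⟦ x ⟧ₘ ⟦ z ⟧ ≡ ⟦ x -ℤ z ⟧ₘ
  dif-⟦⟧ x z = 𝕍.⟦⟧-cong (𝕍.minus-cong (𝕍.ι-⟦⟧ x) (reduce (𝔽.ι-⟦⟧ z)))

  add-⟦⟧ : ∀ x z → add ⟦ x ⟧ₘ ⟦ z ⟧ ≡ ⟦ x +ℤ z ⟧ₘ
  add-⟦⟧ x z = 𝕍.⟦⟧-cong (𝕍.+-cong (𝕍.ι-⟦⟧ x) (reduce (𝔽.ι-⟦⟧ z)))

  shiftₘ-⟦⟧ : ∀ c x → shiftₘ c ⟦ x ⟧ₘ ≡ ⟦ x +ℤ c ⟧ₘ
  shiftₘ-⟦⟧ c x = 𝕍.⟦⟧-cong (𝕍.+-cong (𝕍.ι-⟦⟧ x) 𝕍.≈-refl)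

  shift-⟦⟧ : ∀ c x → shift c ⟦ x ⟧ ≡ ⟦ x +ℤ c ⟧
  shift-⟦⟧ c x = 𝔽.⟦⟧-cong (𝔽.+-cong (𝔽.ι-⟦⟧ x) 𝔽.≈-refl)

  Θ-⟦⟧ : ∀ z → Θ ⟦ z ⟧ ≡ ⟦ θ z ⟧
  Θ-⟦⟧ z = 𝔽.⟦⟧-cong (θ-cong (𝔽.ι-⟦⟧ z))

  Θ⁻¹-⟦⟧ : ∀ z → Θ⁻¹ ⟦ z ⟧ ≡ ⟦ θ⁻¹ z ⟧
  Θ⁻¹-⟦⟧ z = 𝔽.⟦⟧-cong (θ⁻¹-cong (𝔽.ι-⟦⟧ z))

  Θ⁻¹-Θ : ∀ j → Θ⁻¹ (Θ j) ≡ j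
  Θ⁻¹-Θ j = trans (Θ⁻¹-⟦⟧ (θ (ι j))) (trans (𝔽.⟦⟧-cong (θ⁻¹-θ (ι j))) (𝔽.⟦ι⟧ j))

  Θ-Θ⁻¹ : ∀ j → Θ (Θ⁻¹ j) ≡ j
  Θ-Θ⁻¹ j = trans (Θ-⟦⟧ (θ⁻¹ (ι j))) (trans (𝔽.⟦⟧-cong (θ-θ⁻¹ (ι j))) (𝔽.⟦ι⟧ j))

  Θ-injective : ∀ {i j} → Θ i ≡ Θ j → i ≡ j
  Θ-injective {i} {j} eq = trans (sym (Θ⁻¹-Θ i)) (trans (cong Θ⁻¹ eq) (Θ⁻¹-Θ j))

  shift-shift : ∀ c d j → c +ℤ d ≡ + 0 → shift d (shift c j) ≡ j
  shift-shift c d j eq = trans (shift-⟦⟧ d (ι j +ℤ c))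
    (trans (cong ⟦_⟧ (trans (ℤₚ.+-assoc (ι j) c d) (trans (cong (ι j +ℤ_) eq) (ℤₚ.+-identityʳ (ι j))))) (𝔽.⟦ι⟧ j))

  shiftₘ-shiftₘ : ∀ c d k → c +ℤ d ≡ + 0 → shiftₘ d (shiftₘ c k) ≡ k
  shiftₘ-shiftₘ c d k eq = trans (shiftₘ-⟦⟧ d (ιₘ k +ℤ c))
    (trans (cong ⟦_⟧ₘ (trans (ℤₚ.+-assoc (ιₘ k) c d) (trans (cong (ιₘ k +ℤ_) eq) (ℤₚ.+-identityʳ (ιₘ k))))) (𝕍.⟦ι⟧ k))

  shift-injective : ∀ c {i j} → shift c i ≡ shift c j → i ≡ j
  shift-injective c {i} {j} eq = trans (sym (shift-shift c (- c) i (ℤₚ.+-inverseʳ c)))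
    (trans (cong (shift (- c)) eq) (shift-shift c (- c) j (ℤₚ.+-inverseʳ c)))

  shiftₘ-injective : ∀ c {i j} → shiftₘ c i ≡ shiftₘ c j → i ≡ j
  shiftₘ-injective c {i} {j} eq = trans (sym (shiftₘ-shiftₘ c (- c) i (ℤₚ.+-inverseʳ c)))
    (trans (cong (shiftₘ (- c)) eq) (shiftₘ-shiftₘ c (- c) j (ℤₚ.+-inverseʳ c)))

  other-prev : ∀ k f → other k (prev k f) ≡ f
  other-prev k f with x , refl ← 𝕍.representative k | z , refl ← 𝔽.representative f =
    trans (cong (other ⟦ x ⟧ₘ) (prev-⟦⟧ x z)) (trans (other-⟦⟧ x _) (cong ⟦_⟧ (identity (+ 2 *ℤ u *ℤ x) z)))
    where
    identity : ∀ w z → z -ℤ + 1 +ℤ w +ℤ + 1 -ℤ w ≡ z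
    identity = solve-∀

  prev-other : ∀ k j → prev k (other k j) ≡ j
  prev-other k j with x , refl ← 𝕍.representative k | z , refl ← 𝔽.representative j =
    trans (cong (prev ⟦ x ⟧ₘ) (other-⟦⟧ x z)) (trans (prev-⟦⟧ x _) (cong ⟦_⟧ (identity (+ 2 *ℤ u *ℤ x) z)))
    where
    identity : ∀ w z → z +ℤ + 1 -ℤ w -ℤ + 1 +ℤ w ≡ z
    identity = solve-∀

  other-injective : ∀ k {i j} → other k i ≡ other k j → i ≡ j
  other-injective k {i} {j} eq = trans (sym (prev-other k i)) (trans (cong (prev k) eq) (prev-other k j))

  other≢ : ∀ k j → other k j ≢ j
  other≢ k j eq with x , refl ← 𝕍.representative k | z , refl ← 𝔽.representative j =
    odd-not-multiple (- (u *ℤ x)) (subst 𝔽.Multiple (identity u x z)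
      (𝔽.≈⇒multiple (𝔽.⟦⟧-injective (trans (sym (other-⟦⟧ x z)) eq))))
    where
    identity : ∀ u x z → z +ℤ + 1 -ℤ + 2 *ℤ u *ℤ x -ℤ z ≡ + 1 +ℤ + 2 *ℤ (- (u *ℤ x))
    identity = solve-∀

  -- The difference is 2-4uk while 4 divides N. This keeps two edges at an even vertex from having
  -- the same two faces in opposite order.
  other²≢ : ∀ k j → other k (other k j) ≢ j
  other²≢ k j eq with x , refl ← 𝕍.representative k | z , refl ← 𝔽.representative j =
    oddly-even-not-multiple (- (u *ℤ x)) (subst 𝔽.Multiple (identity u x z)
      (𝔽.≈⇒multiple (𝔽.⟦⟧-injective (trans (sym (trans (cong (other ⟦ x ⟧ₘ) (other-⟦⟧ x z)) (other-⟦⟧ x _))) eq))))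
    where
    identity : ∀ u x z → z +ℤ + 1 -ℤ + 2 *ℤ u *ℤ x +ℤ + 1 -ℤ + 2 *ℤ u *ℤ x -ℤ z ≡ + 2 +ℤ + 4 *ℤ (- (u *ℤ x))
    identity = solve-∀

  dif-add : ∀ k f → dif (add k f) f ≡ k
  dif-add k f with x , refl ← 𝕍.representative k | z , refl ← 𝔽.representative f =
    trans (cong (λ t → dif t ⟦ z ⟧) (add-⟦⟧ x z)) (trans (dif-⟦⟧ _ z) (cong ⟦_⟧ₘ (identity x z)))
    where
    identity : ∀ x z → x +ℤ z -ℤ z ≡ x
    identity = solve-∀

  add-dif : ∀ k f → add (dif k f) f ≡ k
  add-dif k f with x , refl ← 𝕍.representative k | z , refl ← 𝔽.representative f =
    trans (cong (λ t → add t ⟦ z ⟧) (dif-⟦⟧ x z)) (trans (add-⟦⟧ _ z) (cong ⟦_⟧ₘ (identity x z)))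
    where
    identity : ∀ x z → x -ℤ z +ℤ z ≡ x
    identity = solve-∀

  -- The index k′ of the even end of the edge with odd vertex `k` and second face `f`. From k′-j = k
  -- and j = f-1+2uk′ follows k′ = k+f-1 modulo m, because m divides 2u.
  low : Fin m → Fin N → Fin m
  low k f = add k (shift (- (+ 1)) f)

  low-⟦⟧ : ∀ x z → low ⟦ x ⟧ₘ ⟦ z ⟧ ≡ ⟦ x +ℤ (z +ℤ - (+ 1)) ⟧ₘ
  low-⟦⟧ x z = trans (cong (add ⟦ x ⟧ₘ) (shift-⟦⟧ (- (+ 1)) z)) (add-⟦⟧ x _)

  dif-low : ∀ k f → dif (low k f) (prev (low k f) f) ≡ k
  dif-low k f with x , refl ← 𝕍.representative k | z , refl ← 𝔽.representative f = begin
    dif (low ⟦ x ⟧ₘ ⟦ z ⟧) (prev (low ⟦ x ⟧ₘ ⟦ z ⟧) ⟦ z ⟧)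
      ≡⟨ cong (λ t → dif t (prev t ⟦ z ⟧)) (low-⟦⟧ x z) ⟩
    dif ⟦ y ⟧ₘ (prev ⟦ y ⟧ₘ ⟦ z ⟧)
      ≡⟨ trans (cong (dif ⟦ y ⟧ₘ) (prev-⟦⟧ y z)) (dif-⟦⟧ y _) ⟩
    ⟦ y -ℤ (z -ℤ + 1 +ℤ + 2 *ℤ u *ℤ y) ⟧ₘ
      ≡⟨ cong ⟦_⟧ₘ (identity (+ 2 *ℤ u *ℤ y) x z) ⟩
    ⟦ x -ℤ + 2 *ℤ u *ℤ y ⟧ₘ
      ≡⟨ 𝕍.⟦⟧-cong (𝕍.minus-cong (𝕍.≈-refl {x}) (2u*≈ₘ0 y)) ⟩
    ⟦ x -ℤ + 0 ⟧ₘ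
      ≡⟨ cong ⟦_⟧ₘ (ℤₚ.+-identityʳ x) ⟩
    ⟦ x ⟧ₘ ∎
    where
    open ≡-Reasoning
    y : ℤ
    y = x +ℤ (z +ℤ - (+ 1))
    identity : ∀ w x z → x +ℤ (z +ℤ - (+ 1)) -ℤ (z -ℤ + 1 +ℤ w) ≡ x -ℤ w
    identity = solve-∀

  low-dif : ∀ k j → low (dif k j) (other k j) ≡ k
  low-dif k j with x , refl ← 𝕍.representative k | z , refl ← 𝔽.representative j = begin
    low (dif ⟦ x ⟧ₘ ⟦ z ⟧) (other ⟦ x ⟧ₘ ⟦ z ⟧)
      ≡⟨ cong₂ low (dif-⟦⟧ x z) (other-⟦⟧ x z) ⟩
    low ⟦ x -ℤ z ⟧ₘ ⟦ z +ℤ + 1 -ℤ + 2 *ℤ u *ℤ x ⟧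
      ≡⟨ low-⟦⟧ _ _ ⟩
    ⟦ x -ℤ z +ℤ (z +ℤ + 1 -ℤ + 2 *ℤ u *ℤ x +ℤ - (+ 1)) ⟧ₘ
      ≡⟨ cong ⟦_⟧ₘ (identity (+ 2 *ℤ u *ℤ x) x z) ⟩
    ⟦ x -ℤ + 2 *ℤ u *ℤ x ⟧ₘ
      ≡⟨ 𝕍.⟦⟧-cong (𝕍.minus-cong (𝕍.≈-refl {x}) (2u*≈ₘ0 x)) ⟩
    ⟦ x -ℤ + 0 ⟧ₘ
      ≡⟨ cong ⟦_⟧ₘ (ℤₚ.+-identityʳ x) ⟩
    ⟦ x ⟧ₘ ∎
    where
    open ≡-Reasoning
    identity : ∀ w x z → x -ℤ z +ℤ (z +ℤ + 1 -ℤ w +ℤ - (+ 1)) ≡ x -ℤ w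
    identity = solve-∀

  other-Θ : ∀ k j → other (dif k j) (Θ (other k j)) ≡ Θ j
  other-Θ k j with x , refl ← 𝕍.representative k | z , refl ← 𝔽.representative j =
    trans (cong₂ other (dif-⟦⟧ x z) (trans (cong Θ (other-⟦⟧ x z)) (Θ-⟦⟧ _)))
      (trans (other-⟦⟧ _ _) (trans (𝔽.⟦⟧-cong (θ-other x z)) (sym (Θ-⟦⟧ z))))

  -- Modulo m the map θ is negation and the twist drops out, so the odd end of the image edge is
  -- 2k+1, the image under σ₁ of the even end 2k.
  dif-Θ : ∀ k j → dif (dif k j) (Θ (other k j)) ≡ shiftₘ (+ 1) k
  dif-Θ k j with x , refl ← 𝕍.representative k | z , refl ← 𝔽.representative j = begin
    dif (dif ⟦ x ⟧ₘ ⟦ z ⟧) (Θ (other ⟦ x ⟧ₘ ⟦ z ⟧))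
      ≡⟨ cong₂ dif (dif-⟦⟧ x z) (trans (cong Θ (other-⟦⟧ x z)) (Θ-⟦⟧ _)) ⟩
    dif ⟦ x -ℤ z ⟧ₘ ⟦ θ (z +ℤ + 1 -ℤ + 2 *ℤ u *ℤ x) ⟧
      ≡⟨ dif-⟦⟧ _ _ ⟩
    ⟦ x -ℤ z -ℤ θ (z +ℤ + 1 -ℤ + 2 *ℤ u *ℤ x) ⟧ₘ
      ≡⟨ 𝕍.⟦⟧-cong (𝕍.minus-cong (𝕍.≈-refl {x -ℤ z}) (θ≈ₘ- _)) ⟩
    ⟦ x -ℤ z -ℤ - (z +ℤ + 1 -ℤ + 2 *ℤ u *ℤ x) ⟧ₘ
      ≡⟨ cong ⟦_⟧ₘ (identity (+ 2 *ℤ u *ℤ x) x z) ⟩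
    ⟦ x +ℤ + 1 -ℤ + 2 *ℤ u *ℤ x ⟧ₘ
      ≡⟨ 𝕍.⟦⟧-cong (𝕍.minus-cong (𝕍.≈-refl {x +ℤ + 1}) (2u*≈ₘ0 x)) ⟩
    ⟦ x +ℤ + 1 -ℤ + 0 ⟧ₘ
      ≡⟨ cong ⟦_⟧ₘ (ℤₚ.+-identityʳ (x +ℤ + 1)) ⟩
    ⟦ x +ℤ + 1 ⟧ₘ
      ≡⟨ sym (shiftₘ-⟦⟧ (+ 1) x) ⟩
    shiftₘ (+ 1) ⟦ x ⟧ₘ ∎
    where
    open ≡-Reasoning
    identity : ∀ w x z → x -ℤ z -ℤ - (z +ℤ + 1 -ℤ w) ≡ x +ℤ + 1 -ℤ w
    identity = solve-∀

  dif-shift : ∀ k j → dif k (shift (+ 1) j) ≡ shiftₘ (- (+ 1)) (dif k j)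
  dif-shift k j with x , refl ← 𝕍.representative k | z , refl ← 𝔽.representative j =
    trans (cong (dif ⟦ x ⟧ₘ) (shift-⟦⟧ (+ 1) z)) (trans (dif-⟦⟧ x _)
      (trans (cong ⟦_⟧ₘ (identity x z)) (sym (trans (cong (shiftₘ (- (+ 1))) (dif-⟦⟧ x z)) (shiftₘ-⟦⟧ (- (+ 1)) _)))))
    where
    identity : ∀ x z → x -ℤ (z +ℤ + 1) ≡ x -ℤ z +ℤ - (+ 1)
    identity = solve-∀

  other-shift : ∀ k j → other k (shift (+ 1) j) ≡ shift (+ 1) (other k j)
  other-shift k j with x , refl ← 𝕍.representative k | z , refl ← 𝔽.representative j =
    trans (cong (other ⟦ x ⟧ₘ) (shift-⟦⟧ (+ 1) z)) (trans (other-⟦⟧ x _)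
      (trans (cong ⟦_⟧ (identity (+ 2 *ℤ u *ℤ x) z)) (sym (trans (cong (shift (+ 1)) (other-⟦⟧ x z)) (shift-⟦⟧ (+ 1) _)))))
    where
    identity : ∀ w z → z +ℤ + 1 +ℤ + 1 -ℤ w ≡ z +ℤ + 1 -ℤ w +ℤ + 1
    identity = solve-∀

  -- inj₁ k and inj₂ k are the cosets σ₁^(2k)⟨σ₂⟩ and σ₁^(2k−1)⟨σ₂⟩. Each coset of
  -- ⟨σ₂σ₁⟩ has exactly one element g in ⟨σ₁², σ₂⟩; the edge (k , j) is the one for
  -- which g lies in σ₁^(2k)⟨σ₂⟩ and in σ₂ʲ⟨σ₁⟩.
  Vertex Edge : Set
  Vertex = Fin m ⊎ Fin m
  Edge = Fin m × Fin N

  onEdge : Vertex → Edge → Bool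
  onEdge (inj₁ k) (k′ , j) = k == k′
  onEdge (inj₂ k) (k′ , j) = k == dif k′ j

  onFace : Edge → Fin N → Bool
  onFace (k , j) f = (f == j) ∨ (f == other k j)

  -- The value `true` marks the rotation orbit of the base flag: the elements g and gσ₂σ₁ of the
  -- coset give the even vertex with face `j` and the odd vertex with face `other k j`.
  hue : Vertex → Edge → Fin N → Bool
  hue (inj₁ _) (_ , j) f = f == j
  hue (inj₂ _) (_ , j) f = not (f == j)

  edge : Bool → Vertex → Fin N → Edge
  edge true  (inj₁ k) f = k , f
  edge false (inj₁ k) f = k , prev k f
  edge false (inj₂ k) f = add k f , f
  edge true  (inj₂ k) f = low k f , prev (low k f) f

  ∨-trueˡ : ∀ {x y} → x ≡ true → x ∨ y ≡ true
  ∨-trueˡ refl = refl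

  ∨-trueʳ : ∀ {x y} → y ≡ true → x ∨ y ≡ true
  ∨-trueʳ {true}  refl = refl
  ∨-trueʳ {false} refl = refl

  onFace-cases : ∀ k j f → onFace (k , j) f ≡ true → f ≡ j ⊎ f ≡ other k j
  onFace-cases k j f eq with f ≟ j
  ... | yes p = inj₁ p
  ... | no _  = inj₂ (==-sound eq)

  onFace₁ : ∀ k j → onFace (k , j) j ≡ true
  onFace₁ k j = ∨-trueˡ {j == j} (==-complete {x = j} refl)

  onFace₂ : ∀ k j → onFace (k , j) (other k j) ≡ true
  onFace₂ k j = ∨-trueʳ {other k j == j} (==-complete {x = other k j} refl)

  onFace-prev : ∀ k f → onFace (k , prev k f) f ≡ true
  onFace-prev k f = subst (λ g → onFace (k , prev k f) g ≡ true) (other-prev k f) (onFace₂ k (prev k f))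

  prev≢ : ∀ k f → f ≢ prev k f
  prev≢ k f eq = other≢ k (prev k f) (trans (other-prev k f) eq)

  edge-onEdge : ∀ c v f → onEdge v (edge c v f) ≡ true
  edge-onEdge true  (inj₁ k) f = ==-complete {x = k} refl
  edge-onEdge false (inj₁ k) f = ==-complete {x = k} refl
  edge-onEdge false (inj₂ k) f = ==-complete (sym (dif-add k f))
  edge-onEdge true  (inj₂ k) f = ==-complete (sym (dif-low k f))

  edge-onFace : ∀ c v f → onFace (edge c v f) f ≡ true
  edge-onFace true  (inj₁ k) f = onFace₁ k f
  edge-onFace false (inj₁ k) f = onFace-prev k f
  edge-onFace false (inj₂ k) f = onFace₁ (add k f) f
  edge-onFace true  (inj₂ k) f = onFace-prev (low k f) f

  edge-hue : ∀ c v f → hue v (edge c v f) f ≡ c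
  edge-hue true  (inj₁ k) f = ==-complete {x = f} refl
  edge-hue false (inj₁ k) f = ==-false (prev≢ k f)
  edge-hue false (inj₂ k) f = cong not (==-complete {x = f} refl)
  edge-hue true  (inj₂ k) f = cong not (==-false (prev≢ (low k f) f))

  edge-unique′ : ∀ v e f → onEdge v e ≡ true → onFace e f ≡ true → e ≡ edge (hue v e f) v f
  edge-unique′ v (k , j) f ve ef with onFace-cases k j f ef
  edge-unique′ (inj₁ k′) (k , j) .j ve ef | inj₁ refl
    rewrite ==-complete {x = j} refl = cong (_, j) (sym (==-sound ve))
  edge-unique′ (inj₂ k′) (k , j) .j ve ef | inj₁ refl
    rewrite ==-complete {x = j} refl = cong (_, j) (trans (sym (add-dif k j)) (cong (λ t → add t j) (sym (==-sound ve))))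
  edge-unique′ (inj₁ k′) (k , j) ._ ve ef | inj₂ refl
    rewrite ==-false (other≢ k j) | ==-sound {x = k′} {k} ve = cong (k ,_) (sym (prev-other k j))
  edge-unique′ (inj₂ k′) (k , j) ._ ve ef | inj₂ refl
    rewrite ==-false (other≢ k j) | ==-sound {x = k′} {dif k j} ve | low-dif k j = cong (k ,_) (sym (prev-other k j))

  hue-vertex : ∀ e f → Separates (λ v → onEdge v e ≡ true) (λ v → hue v e f)
  hue-vertex (k , j) f {inj₁ a} {inj₁ b} p q eq = cong inj₁ (trans (==-sound p) (sym (==-sound q)))
  hue-vertex (k , j) f {inj₂ a} {inj₂ b} p q eq = cong inj₂ (trans (==-sound p) (sym (==-sound q)))
  hue-vertex (k , j) f {inj₁ a} {inj₂ b} p q eq = ⊥-elim (not-¬ refl eq)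
  hue-vertex (k , j) f {inj₂ a} {inj₁ b} p q eq = ⊥-elim (not-¬ refl (sym eq))

  first-face-separates : ∀ k j → Separates (λ f → onFace (k , j) f ≡ true) (λ f → f == j)
  first-face-separates k j {f} {g} p q eq with onFace-cases k j f p | onFace-cases k j g q
  ... | inj₁ refl | _         = sym (==-sound (trans (sym eq) (==-complete {x = j} refl)))
  ... | inj₂ _    | inj₁ refl = ==-sound (trans eq (==-complete {x = j} refl))
  ... | inj₂ r    | inj₂ s    = trans r (sym s)

  hue-face : ∀ v e → Separates (λ f → onFace e f ≡ true) (λ f → hue v e f)
  hue-face (inj₁ _) (k , j) p q eq = first-face-separates k j p q eq
  hue-face (inj₂ _) (k , j) p q eq = first-face-separates k j p q (not-injective eq)

  vertex : ∀ e f c → ∃ λ v → onEdge v e ≡ true × hue v e f ≡ c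
  vertex (k , j) f c with f == j in eq | c
  ... | true  | true  = inj₁ k , ==-complete {x = k} refl , eq
  ... | false | false = inj₁ k , ==-complete {x = k} refl , eq
  ... | true  | false = inj₂ (dif k j) , ==-complete {x = dif k j} refl , cong not eq
  ... | false | true  = inj₂ (dif k j) , ==-complete {x = dif k j} refl , cong not eq

  face : ∀ v e c → ∃ λ f → onFace e f ≡ true × hue v e f ≡ c
  face (inj₁ _) (k , j) true  = j , onFace₁ k j , ==-complete {x = j} refl
  face (inj₁ _) (k , j) false = other k j , onFace₂ k j , ==-false (other≢ k j)
  face (inj₂ _) (k , j) false = j , onFace₁ k j , cong not (==-complete {x = j} refl)
  face (inj₂ _) (k , j) true  = other k j , onFace₂ k j , cong not (==-false (other≢ k j))

  opaque
    decodeV : Fin (m + m) → Vertex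
    decodeV = splitAt m

    encodeV : Vertex → Fin (m + m)
    encodeV = join m m

    decodeE : Fin (m * N) → Edge
    decodeE = remQuot N

    encodeE : Edge → Fin (m * N)
    encodeE (k , j) = combine k j

    decode-encodeV : ∀ v → decodeV (encodeV v) ≡ v
    decode-encodeV = splitAt-join m m

    encode-decodeV : ∀ v → encodeV (decodeV v) ≡ v
    encode-decodeV = join-splitAt m m

    decode-encodeE : ∀ e → decodeE (encodeE e) ≡ e
    decode-encodeE (k , j) = remQuot-combine k j

    encode-decodeE : ∀ e → encodeE (decodeE e) ≡ e
    encode-decodeE e = combine-remQuot {m} N e

  decodeV-injective : ∀ {v w} → decodeV v ≡ decodeV w → v ≡ w
  decodeV-injective {v} {w} eq = trans (sym (encode-decodeV v)) (trans (cong encodeV eq) (encode-decodeV w))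

  decodeE-injective : ∀ {d e} → decodeE d ≡ decodeE e → d ≡ e
  decodeE-injective {d} {e} eq = trans (sym (encode-decodeE d)) (trans (cong encodeE eq) (encode-decodeE e))

  flatMap : FlatMap
  flatMap = record
    { nV = m + m ; nE = m * N ; nF = N
    ; VE = λ v e → onEdge (decodeV v) (decodeE e)
    ; EF = λ e f → onFace (decodeE e) f
    ; colour = λ v e f → hue (decodeV v) (decodeE e) f
    ; edgeOf = λ c v f → encodeE (edge c (decodeV v) f)
    ; edgeOf-VE = λ c v f → trans (cong (onEdge (decodeV v)) (decode-encodeE _)) (edge-onEdge c (decodeV v) f)
    ; edgeOf-EF = λ c v f → trans (cong (λ e → onFace e f) (decode-encodeE _)) (edge-onFace c (decodeV v) f)
    ; edgeOf-colour = λ c v f → trans (cong (λ e → hue (decodeV v) e f) (decode-encodeE _)) (edge-hue c (decodeV v) f)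
    ; edgeOf-unique = λ v e f p q → trans (sym (encode-decodeE e)) (cong encodeE (edge-unique′ (decodeV v) (decodeE e) f p q))
    ; colour-vertex = λ e f p q eq → decodeV-injective (hue-vertex (decodeE e) f p q eq)
    ; colour-face = λ v e p q eq → hue-face (decodeV v) (decodeE e) p q eq
    ; vertexOf = λ e f c → let v , p , q = vertex (decodeE e) f c in
        encodeV v , trans (cong (λ w → onEdge w (decodeE e)) (decode-encodeV v)) p
                  , trans (cong (λ w → hue w (decodeE e) f) (decode-encodeV v)) q
    ; faceOf = λ v e c → face (decodeV v) (decodeE e) c
    ; v₀ = encodeV (inj₁ ⟦ + 0 ⟧ₘ)
    ; f₀ = ⟦ + 0 ⟧ }

  open FlatMap flatMap using (incidence; v₀; f₀)

  -- The two rotations as automorphisms.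

  module _ {n : ℕ} {X : Set} (decode : Fin n → X) (encode : X → Fin n)
           (decode-encode : ∀ x → decode (encode x) ≡ x) (encode-decode : ∀ i → encode (decode i) ≡ i) where

    encodePerm : (f g : X → X) → (∀ x → f (g x) ≡ x) → (∀ x → g (f x) ≡ x) → Perm incidence n
    encodePerm f g fg gf = record
      { to = λ i → encode (f (decode i)) ; from = λ i → encode (g (decode i))
      ; to-from = λ i → trans (cong (λ x → encode (f x)) (decode-encode _)) (trans (cong encode (fg _)) (encode-decode i))
      ; from-to = λ i → trans (cong (λ x → encode (g x)) (decode-encode _)) (trans (cong encode (gf _)) (encode-decode i)) }

  -- As `inj₂ k` is the vertex 2k-1, the step from 2k to 2k+1 raises the index and the step from
  -- 2k-1 to 2k keeps it.
  aV aV⁻¹ bV bV⁻¹ : Vertex → Vertex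
  aV (inj₁ k) = inj₂ (shiftₘ (+ 1) k)
  aV (inj₂ k) = inj₁ k
  aV⁻¹ (inj₁ k) = inj₂ k
  aV⁻¹ (inj₂ k) = inj₁ (shiftₘ (- (+ 1)) k)
  bV (inj₁ k) = inj₁ k
  bV (inj₂ k) = inj₂ (shiftₘ (- (+ 1)) k)
  bV⁻¹ (inj₁ k) = inj₁ k
  bV⁻¹ (inj₂ k) = inj₂ (shiftₘ (+ 1) k)

  -- σ₁g leaves ⟨σ₁², σ₂⟩, so the image edge is represented by σ₁gσ₂σ₁: its even vertex is the image
  -- of the odd one and its first face the image of the second. σ₂g stays in the subgroup, and
  -- nothing is interchanged.
  aE aE⁻¹ bE bE⁻¹ : Edge → Edge
  aE (k , j) = dif k j , Θ (other k j)
  aE⁻¹ (k , j) = add k (Θ⁻¹ (other k j)) , Θ⁻¹ (other k j)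
  bE (k , j) = k , shift (+ 1) j
  bE⁻¹ (k , j) = k , shift (- (+ 1)) j

  aV-aV⁻¹ : ∀ v → aV (aV⁻¹ v) ≡ v
  aV-aV⁻¹ (inj₁ k) = refl
  aV-aV⁻¹ (inj₂ k) = cong inj₂ (shiftₘ-shiftₘ (- (+ 1)) (+ 1) k refl)

  aV⁻¹-aV : ∀ v → aV⁻¹ (aV v) ≡ v
  aV⁻¹-aV (inj₁ k) = cong inj₁ (shiftₘ-shiftₘ (+ 1) (- (+ 1)) k refl)
  aV⁻¹-aV (inj₂ k) = refl

  bV-bV⁻¹ : ∀ v → bV (bV⁻¹ v) ≡ v
  bV-bV⁻¹ (inj₁ k) = refl
  bV-bV⁻¹ (inj₂ k) = cong inj₂ (shiftₘ-shiftₘ (+ 1) (- (+ 1)) k refl)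

  bV⁻¹-bV : ∀ v → bV⁻¹ (bV v) ≡ v
  bV⁻¹-bV (inj₁ k) = refl
  bV⁻¹-bV (inj₂ k) = cong inj₂ (shiftₘ-shiftₘ (- (+ 1)) (+ 1) k refl)

  aE-aE⁻¹ : ∀ e → aE (aE⁻¹ e) ≡ e
  aE-aE⁻¹ (k , j) = cong₂ _,_ (dif-add k i) (other-injective k (begin
    other k (Θ (other (add k i) i))                       ≡⟨ cong (λ t → other t (Θ (other (add k i) i))) (sym (dif-add k i)) ⟩
    other (dif (add k i) i) (Θ (other (add k i) i))       ≡⟨ other-Θ (add k i) i ⟩
    Θ i                                                   ≡⟨ Θ-Θ⁻¹ (other k j) ⟩
    other k j                                             ∎))
    where
    open ≡-Reasoning
    i : Fin N
    i = Θ⁻¹ (other k j)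

  aE⁻¹-aE : ∀ e → aE⁻¹ (aE e) ≡ e
  aE⁻¹-aE (k , j) = trans (cong (λ i → add (dif k j) i , i) (trans (cong Θ⁻¹ (other-Θ k j)) (Θ⁻¹-Θ j)))
                          (cong (_, j) (add-dif k j))

  bE-bE⁻¹ : ∀ e → bE (bE⁻¹ e) ≡ e
  bE-bE⁻¹ (k , j) = cong (k ,_) (shift-shift (- (+ 1)) (+ 1) j refl)

  bE⁻¹-bE : ∀ e → bE⁻¹ (bE e) ≡ e
  bE⁻¹-bE (k , j) = cong (k ,_) (shift-shift (+ 1) (- (+ 1)) j refl)

  a-onEdge : ∀ v e → onEdge (aV v) (aE e) ≡ onEdge v e
  a-onEdge (inj₁ k) (k′ , j) = trans (cong (shiftₘ (+ 1) k ==_) (dif-Θ k′ j))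
    (==-injection (shiftₘ (+ 1)) (shiftₘ-injective (+ 1)) k k′)
  a-onEdge (inj₂ k) (k′ , j) = refl

  b-onEdge : ∀ v e → onEdge (bV v) (bE e) ≡ onEdge v e
  b-onEdge (inj₁ k) (k′ , j) = refl
  b-onEdge (inj₂ k) (k′ , j) = trans (cong (shiftₘ (- (+ 1)) k ==_) (dif-shift k′ j))
    (==-injection (shiftₘ (- (+ 1))) (shiftₘ-injective (- (+ 1))) k (dif k′ j))

  a-onFace : ∀ e f → onFace (aE e) (Θ f) ≡ onFace e f
  a-onFace (k , j) f = trans
    (cong₂ _∨_ (==-injection Θ Θ-injective f (other k j))
               (trans (cong (Θ f ==_) (other-Θ k j)) (==-injection Θ Θ-injective f j)))
    (∨-comm (f == other k j) (f == j))

  b-onFace : ∀ e f → onFace (bE e) (shift (+ 1) f) ≡ onFace e f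
  b-onFace (k , j) f = cong₂ _∨_ (==-injection (shift (+ 1)) (shift-injective (+ 1)) f j)
    (trans (cong (shift (+ 1) f ==_) (other-shift k j)) (==-injection (shift (+ 1)) (shift-injective (+ 1)) f (other k j)))

  swap-faces : ∀ k j f → onFace (k , j) f ≡ true → not (f == other k j) ≡ (f == j)
  swap-faces k j f ef with onFace-cases k j f ef
  ... | inj₁ refl = trans (cong not (==-false (λ eq → other≢ k j (sym eq)))) (sym (==-complete {x = j} refl))
  ... | inj₂ refl = trans (cong not (==-complete {x = other k j} refl)) (sym (==-false (other≢ k j)))

  a-hue : ∀ v e f → onFace e f ≡ true → hue (aV v) (aE e) (Θ f) ≡ hue v e f
  a-hue (inj₁ _) (k , j) f ef = trans (cong not (==-injection Θ Θ-injective f (other k j))) (swap-faces k j f ef)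
  a-hue (inj₂ _) (k , j) f ef = trans (==-injection Θ Θ-injective f (other k j))
    (trans (sym (not-involutive _)) (cong not (swap-faces k j f ef)))

  b-hue : ∀ v e f → hue (bV v) (bE e) (shift (+ 1) f) ≡ hue v e f
  b-hue (inj₁ _) (k , j) f = ==-injection (shift (+ 1)) (shift-injective (+ 1)) f j
  b-hue (inj₂ _) (k , j) f = cong not (==-injection (shift (+ 1)) (shift-injective (+ 1)) f j)

  a : Aut incidence
  a = record
    { πV = encodePerm decodeV encodeV decode-encodeV encode-decodeV aV aV⁻¹ aV-aV⁻¹ aV⁻¹-aV
    ; πE = encodePerm decodeE encodeE decode-encodeE encode-decodeE aE aE⁻¹ aE-aE⁻¹ aE⁻¹-aE
    ; πF = record { to = Θ ; from = Θ⁻¹ ; to-from = Θ-Θ⁻¹ ; from-to = Θ⁻¹-Θ }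
    ; presVE = λ v e → trans (cong₂ onEdge (decode-encodeV _) (decode-encodeE _)) (a-onEdge (decodeV v) (decodeE e))
    ; presEF = λ e f → trans (cong (λ x → onFace x (Θ f)) (decode-encodeE _)) (a-onFace (decodeE e) f)
    ; presVF = λ _ _ → refl }

  b : Aut incidence
  b = record
    { πV = encodePerm decodeV encodeV decode-encodeV encode-decodeV bV bV⁻¹ bV-bV⁻¹ bV⁻¹-bV
    ; πE = encodePerm decodeE encodeE decode-encodeE encode-decodeE bE bE⁻¹ bE-bE⁻¹ bE⁻¹-bE
    ; πF = record { to = shift (+ 1) ; from = shift (- (+ 1))
                  ; to-from = λ j → shift-shift (- (+ 1)) (+ 1) j refl
                  ; from-to = λ j → shift-shift (+ 1) (- (+ 1)) j refl }
    ; presVE = λ v e → trans (cong₂ onEdge (decode-encodeV _) (decode-encodeE _)) (b-onEdge (decodeV v) (decodeE e))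
    ; presEF = λ e f → trans (cong (λ x → onFace x (shift (+ 1) f)) (decode-encodeE _)) (b-onFace (decodeE e) f)
    ; presVF = λ _ _ → refl }

  V[_] : Aut incidence → Fin (m + m) → Fin (m + m)
  V[ α ] = to (πV α)

  F[_] : Aut incidence → Fin N → Fin N
  F[ α ] = to (πF α)

  a⁻¹ b⁻¹ : Aut incidence
  a⁻¹ = autInv incidence a
  b⁻¹ = autInv incidence b

  a-encode : ∀ v → V[ a ] (encodeV v) ≡ encodeV (aV v)
  a-encode v = cong (λ x → encodeV (aV x)) (decode-encodeV v)

  a⁻¹-encode : ∀ v → V[ a⁻¹ ] (encodeV v) ≡ encodeV (aV⁻¹ v)
  a⁻¹-encode v = cong (λ x → encodeV (aV⁻¹ x)) (decode-encodeV v)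

  b-encode : ∀ v → V[ b ] (encodeV v) ≡ encodeV (bV v)
  b-encode v = cong (λ x → encodeV (bV x)) (decode-encodeV v)

  b⁻¹-encode : ∀ v → V[ b⁻¹ ] (encodeV v) ≡ encodeV (bV⁻¹ v)
  b⁻¹-encode v = cong (λ x → encodeV (bV⁻¹ x)) (decode-encodeV v)

  encodeV-injective : ∀ {v w} → encodeV v ≡ encodeV w → v ≡ w
  encodeV-injective {v} {w} eq = trans (sym (decode-encodeV v)) (trans (cong decodeV eq) (decode-encodeV w))

  -- Orbits of the base cells, and the missing reflection.

  a-twice : ∀ x → V[ a ] (V[ a ] (encodeV (inj₁ ⟦ x ⟧ₘ))) ≡ encodeV (inj₁ ⟦ x +ℤ + 1 ⟧ₘ)
  a-twice x = trans (cong V[ a ] (a-encode _)) (trans (a-encode _) (cong (λ k → encodeV (inj₁ k)) (shiftₘ-⟦⟧ (+ 1) x)))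

  a-even : ∀ n → iter V[ a ] (n * 2) v₀ ≡ encodeV (inj₁ ⟦ + n ⟧ₘ)
  a-even zero    = refl
  a-even (suc n) = trans (cong (λ v → V[ a ] (V[ a ] v)) (a-even n))
    (trans (a-twice (+ n)) (cong (λ k → encodeV (inj₁ ⟦ + k ⟧ₘ)) (ℕₚ.+-comm n 1)))

  a-odd : ∀ n → iter V[ a ] (suc (n * 2)) v₀ ≡ encodeV (inj₂ (shiftₘ (+ 1) ⟦ + n ⟧ₘ))
  a-odd n = trans (cong V[ a ] (a-even n)) (a-encode _)

  b-iter : ∀ n → iter F[ b ] n f₀ ≡ ⟦ + n ⟧
  b-iter zero    = refl
  b-iter (suc n) = trans (cong F[ b ] (b-iter n)) (trans (shift-⟦⟧ (+ 1) (+ n)) (cong (λ k → ⟦ + k ⟧) (ℕₚ.+-comm n 1)))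

  b⁻¹-iter : ∀ n → iter F[ b⁻¹ ] n f₀ ≡ ⟦ - (+ n) ⟧
  b⁻¹-iter zero    = refl
  b⁻¹-iter (suc n) = trans (cong F[ b⁻¹ ] (b⁻¹-iter n)) (trans (shift-⟦⟧ (- (+ 1)) (- (+ n))) (cong ⟦_⟧ (identity (+ n))))
    where
    identity : ∀ n → - n +ℤ - (+ 1) ≡ - (+ 1 +ℤ n)
    identity = solve-∀

  θ-0 : θ (+ 0) ≡ + 0
  θ-0 = identity u
    where
    identity : ∀ u → - (+ 0) -ℤ u *ℤ (+ 0 *ℤ (+ 0 -ℤ + 1)) ≡ + 0
    identity = solve-∀

  θ⁻¹-0 : θ⁻¹ (+ 0) ≡ + 0
  θ⁻¹-0 = identity u
    where
    identity : ∀ u → - (+ 0) -ℤ u *ℤ (+ 0 *ℤ (+ 0 +ℤ + 1)) ≡ + 0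
    identity = solve-∀

  θ-1 : θ (+ 1) ≡ - (+ 1)
  θ-1 = identity u
    where
    identity : ∀ u → - (+ 1) -ℤ u *ℤ (+ 1 *ℤ (+ 1 -ℤ + 1)) ≡ - (+ 1)
    identity = solve-∀

  Θ-f₀ : Θ f₀ ≡ f₀
  Θ-f₀ = trans (Θ-⟦⟧ (+ 0)) (cong ⟦_⟧ θ-0)

  vertex-orbit′ : ∀ v → ∃ λ n → iter V[ a ] n v₀ ≡ v
  vertex-orbit′ v = subst (λ w → ∃ λ n → iter V[ a ] n v₀ ≡ w) (encode-decodeV v) (orbit (decodeV v))
    where
    orbit : ∀ x → ∃ λ n → iter V[ a ] n v₀ ≡ encodeV x
    orbit (inj₁ k) = toℕ k * 2 , trans (a-even (toℕ k)) (cong (λ t → encodeV (inj₁ t)) (𝕍.⟦ι⟧ k))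
    orbit (inj₂ k) = suc (toℕ (shiftₘ (- (+ 1)) k) * 2) , trans (a-odd (toℕ (shiftₘ (- (+ 1)) k)))
      (cong (λ t → encodeV (inj₂ t)) (trans (cong (shiftₘ (+ 1)) (𝕍.⟦ι⟧ _)) (shiftₘ-shiftₘ (- (+ 1)) (+ 1) k refl)))

  edge-determined′ : ∀ d e → (∀ v → onEdge v d ≡ true → onEdge v e ≡ true) →
    (∀ f → onFace d f ≡ true → onFace e f ≡ true) → d ≡ e
  edge-determined′ (k , j) (k′ , j′) sameV sameF with ==-sound {x = k} {k′} (sameV (inj₁ k) (==-complete {x = k} refl))
  ... | refl with onFace-cases k j′ j (sameF j (onFace₁ k j))
                | onFace-cases k j′ (other k j) (sameF (other k j) (onFace₂ k j))
  ...   | inj₁ refl | _      = refl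
  ...   | inj₂ p    | inj₁ q = ⊥-elim (other²≢ k j (trans (cong (other k) q) (sym p)))
  ...   | inj₂ p    | inj₂ q = cong (k ,_) (other-injective k q)

  -- A reflection would send the edge (1 , 0), whose faces are 0 and 1 − 2u, to an
  -- edge at the vertex −2 with faces 0 and −1 + 2u; there is none since N ∤ 4u.
  no-reflection′ : ∀ (γ : Aut incidence) →
    (∀ n → V[ γ ] (iter V[ a ] n v₀) ≡ iter V[ a⁻¹ ] n v₀) →
    (∀ n → F[ γ ] (iter F[ b ] n f₀) ≡ iter F[ b⁻¹ ] n f₀) → ⊥
  no-reflection′ γ γV γF = impossible (decodeE (to (πE γ) e)) on-vertex (on-face ⟦ + 0 ⟧ first) (on-face _ second)
    where
    e : Fin (m * N)
    e = encodeE (⟦ + 1 ⟧ₘ , ⟦ + 0 ⟧)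
    γ-face : ∀ f → F[ γ ] f ≡ ⟦ - ι f ⟧
    γ-face f = trans (cong F[ γ ] (sym (trans (b-iter (toℕ f)) (𝔽.⟦ι⟧ f)))) (trans (γF (toℕ f)) (b⁻¹-iter (toℕ f)))
    γ-vertex : V[ γ ] (encodeV (inj₁ ⟦ + 1 ⟧ₘ)) ≡ encodeV (inj₁ ⟦ - (+ 1) ⟧ₘ)
    γ-vertex = trans (cong V[ γ ] (sym (a-even 1))) (trans (γV 2)
      (trans (cong V[ a⁻¹ ] (a⁻¹-encode _)) (trans (a⁻¹-encode _) (cong (λ k → encodeV (inj₁ k)) (shiftₘ-⟦⟧ (- (+ 1)) (+ 0))))))
    on-vertex : onEdge (inj₁ ⟦ - (+ 1) ⟧ₘ) (decodeE (to (πE γ) e)) ≡ true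
    on-vertex = trans (cong (λ v → onEdge v (decodeE (to (πE γ) e))) (sym (trans (cong decodeV γ-vertex) (decode-encodeV _))))
      (trans (presVE γ (encodeV (inj₁ ⟦ + 1 ⟧ₘ)) e)
        (trans (cong₂ onEdge (decode-encodeV _) (decode-encodeE _)) (==-complete {x = ⟦ + 1 ⟧ₘ} refl)))
    on-face : ∀ f → onFace (⟦ + 1 ⟧ₘ , ⟦ + 0 ⟧) f ≡ true → onFace (decodeE (to (πE γ) e)) ⟦ - ι f ⟧ ≡ true
    on-face f p = trans (cong (onFace (decodeE (to (πE γ) e))) (sym (γ-face f)))
      (trans (presEF γ e f) (trans (cong (λ d → onFace d f) (decode-encodeE _)) p))
    first : onFace (⟦ + 1 ⟧ₘ , ⟦ + 0 ⟧) ⟦ + 0 ⟧ ≡ true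
    first = onFace₁ ⟦ + 1 ⟧ₘ ⟦ + 0 ⟧
    second : onFace (⟦ + 1 ⟧ₘ , ⟦ + 0 ⟧) ⟦ + 1 -ℤ + 2 *ℤ u ⟧ ≡ true
    second = subst (λ f → onFace (⟦ + 1 ⟧ₘ , ⟦ + 0 ⟧) f ≡ true)
      (trans (other-⟦⟧ (+ 1) (+ 0)) (cong ⟦_⟧ (identity u))) (onFace₂ ⟦ + 1 ⟧ₘ ⟦ + 0 ⟧)
      where
      identity : ∀ u → + 0 +ℤ + 1 -ℤ + 2 *ℤ u *ℤ + 1 ≡ + 1 -ℤ + 2 *ℤ u
      identity = solve-∀
    from-first : ⟦ - ι ⟦ + 0 ⟧ ⟧ ≡ ⟦ + 0 ⟧
    from-first = 𝔽.⟦⟧-cong (𝔽.neg-cong (𝔽.ι-⟦⟧ (+ 0)))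
    from-second : ⟦ - ι ⟦ + 1 -ℤ + 2 *ℤ u ⟧ ⟧ ≡ ⟦ - (+ 1 -ℤ + 2 *ℤ u) ⟧
    from-second = 𝔽.⟦⟧-cong (𝔽.neg-cong (𝔽.ι-⟦⟧ _))
    impossible : ∀ d → onEdge (inj₁ ⟦ - (+ 1) ⟧ₘ) d ≡ true →
      onFace d ⟦ - ι ⟦ + 0 ⟧ ⟧ ≡ true → onFace d ⟦ - ι ⟦ + 1 -ℤ + 2 *ℤ u ⟧ ⟧ ≡ true → ⊥
    impossible (k , j) v f g rewrite sym (==-sound {x = ⟦ - (+ 1) ⟧ₘ} {k} v) | from-first | from-second
      with z , refl ← 𝔽.representative j
      with onFace-cases ⟦ - (+ 1) ⟧ₘ ⟦ z ⟧ _ f | onFace-cases ⟦ - (+ 1) ⟧ₘ ⟦ z ⟧ _ g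
    -- An edge at the vertex -2 is (-1 , z), with faces z and z+1+2u. If 0 and -1+2u are both the
    -- same one of these, the odd number -1+2u is a multiple of N.
    ... | inj₁ p | inj₁ q = odd-not-multiple (u -ℤ + 1) (subst 𝔽.Multiple (identity u)
              (𝔽.≈⇒multiple (𝔽.⟦⟧-injective (trans q (sym p)))))
      where
      identity : ∀ u → - (+ 1 -ℤ + 2 *ℤ u) -ℤ + 0 ≡ + 1 +ℤ + 2 *ℤ (u -ℤ + 1)
      identity = solve-∀
    ... | inj₂ p | inj₂ q = odd-not-multiple (u -ℤ + 1) (subst 𝔽.Multiple (identity u)
              (𝔽.≈⇒multiple (𝔽.⟦⟧-injective (trans q (sym p)))))
      where
      identity : ∀ u → - (+ 1 -ℤ + 2 *ℤ u) -ℤ + 0 ≡ + 1 +ℤ + 2 *ℤ (u -ℤ + 1)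
      identity = solve-∀
    -- Here z = 0 and -1+2u agrees with 1+2u, a difference of -2, while 4 divides N.
    ... | inj₁ p | inj₂ q = oddly-even-not-multiple (- (+ 1)) (subst 𝔽.Multiple (identity u)
              (𝔽.≈⇒multiple (𝔽.⟦⟧-injective (trans q (trans (cong (other ⟦ - (+ 1) ⟧ₘ) (sym p)) (other-⟦⟧ (- (+ 1)) (+ 0)))))))
      where
      identity : ∀ u → - (+ 1 -ℤ + 2 *ℤ u) -ℤ (+ 0 +ℤ + 1 -ℤ + 2 *ℤ u *ℤ - (+ 1)) ≡ + 2 +ℤ + 4 *ℤ - (+ 1)
      identity = solve-∀
    -- Here z = -1+2u and the second face 4u would have to be 0; divisibility by 4 gives no
    -- contradiction, only the twist does.
    ... | inj₂ p | inj₁ q with r , eq ← 𝔽.≈⇒multiple (𝔽.⟦⟧-injective (trans p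
              (trans (cong (other ⟦ - (+ 1) ⟧ₘ) (sym q)) (other-⟦⟧ (- (+ 1)) (- (+ 1 -ℤ + 2 *ℤ u)))))) =
      N∤4u (- r) (trans (identity u) (trans (cong -_ eq) (ℤₚ.neg-distribˡ-* r (+ N))))
      where
      identity : ∀ u → + 4 *ℤ u ≡ - (+ 0 -ℤ (- (+ 1 -ℤ + 2 *ℤ u) +ℤ + 1 -ℤ + 2 *ℤ u *ℤ - (+ 1)))
      identity = solve-∀

  decode-v₀ : decodeV v₀ ≡ inj₁ ⟦ + 0 ⟧ₘ
  decode-v₀ = decode-encodeV _

  base-edge : FlatMap.edgeOf flatMap false v₀ f₀ ≡ encodeE (⟦ + 0 ⟧ₘ , ⟦ - (+ 1) ⟧)
  base-edge = trans (cong (λ v → encodeE (edge false v f₀)) decode-v₀)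
    (cong (λ j → encodeE (⟦ + 0 ⟧ₘ , j)) (trans (prev-⟦⟧ (+ 0) (+ 0)) (cong ⟦_⟧ (identity u))))
    where
    identity : ∀ u → + 0 -ℤ + 1 +ℤ + 2 *ℤ u *ℤ + 0 ≡ - (+ 1)
    identity = solve-∀

  base-edge′ : FlatMap.edgeOf flatMap true v₀ f₀ ≡ encodeE (⟦ + 0 ⟧ₘ , ⟦ + 0 ⟧)
  base-edge′ = cong (λ v → encodeE (edge true v f₀)) decode-v₀

  rotary : Rotary flatMap
  rotary = record
    { s₁ = a ; s₂ = b
    ; colour₁ = λ {v} {e} {f} at → trans (cong₂ (λ x y → hue x y (Θ f)) (decode-encodeV _) (decode-encodeE _))
                                     (a-hue (decodeV v) (decodeE e) f (proj₂ at))
    ; colour₂ = λ {v} {e} {f} at → trans (cong₂ (λ x y → hue x y (shift (+ 1) f)) (decode-encodeV _) (decode-encodeE _))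
                                     (b-hue (decodeV v) (decodeE e) f)
    ; s₁-f₀ = Θ-f₀
    ; s₂-v₀ = b-encode _
    ; s₁-v₀ = λ eq → inj₂≢inj₁ (encodeV-injective (trans (sym (a-encode (inj₁ ⟦ + 0 ⟧ₘ))) eq))
    ; s₂-f₀ = λ eq → odd-not-multiple (+ 0)
                (𝔽.≈⇒multiple (𝔽.⟦⟧-injective (trans (sym (shift-⟦⟧ (+ 1) (+ 0))) eq)))
    ; s₁-e₀ = trans (cong (to (πE a)) base-edge′) (trans (cong (λ x → encodeE (aE x)) (decode-encodeE (⟦ + 0 ⟧ₘ , ⟦ + 0 ⟧)))
                (trans (cong₂ (λ x y → encodeE (x , y)) (dif-⟦⟧ (+ 0) (+ 0))
                  (trans (cong Θ (trans (other-⟦⟧ (+ 0) (+ 0)) (cong ⟦_⟧ (identity u)))) (trans (Θ-⟦⟧ (+ 1)) (cong ⟦_⟧ θ-1))))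
                  (sym base-edge)))
    ; s₂-e₁ = trans (cong (to (πE b)) base-edge) (trans (cong (λ x → encodeE (bE x)) (decode-encodeE (⟦ + 0 ⟧ₘ , ⟦ - (+ 1) ⟧)))
                (trans (cong (λ y → encodeE (⟦ + 0 ⟧ₘ , y)) (shift-⟦⟧ (+ 1) (- (+ 1)))) (sym base-edge′)))
    ; vertex-orbit = vertex-orbit′
    ; face-orbit = λ f → toℕ f , trans (b-iter (toℕ f)) (𝔽.⟦ι⟧ f)
    ; edge-determined = λ d e p q → decodeE-injective (edge-determined′ (decodeE d) (decodeE e)
        (λ v r → trans (cong (λ w → onEdge w (decodeE e)) (sym (decode-encodeV v)))
                   (p (encodeV v) (trans (cong (λ w → onEdge w (decodeE d)) (decode-encodeV v)) r)))
        q)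
    ; no-reflection = no-reflection′ }
    where
    inj₂≢inj₁ : ∀ {x y : Fin m} → _≢_ {A = Vertex} (inj₂ x) (inj₁ y)
    inj₂≢inj₁ ()
    identity : ∀ u → + 0 +ℤ + 1 -ℤ + 2 *ℤ u *ℤ + 0 ≡ + 1
    identity = solve-∀

  open Rotary rotary using (ev; AgreeAtBase; isPolyhedron; isChiral; isAutGroup; pow₁-v₀; pow₂-f₀; pow₂-v₀)

  -- Orders of the rotations and the defining relations at the base.

  order-a : ∀ n → iter V[ a ] n v₀ ≡ v₀ → ∃ λ k → n ≡ k * (m + m)
  order-a n eq with half n
  ... | k , inj₁ refl
    with q , refl ← 𝕍.multiple-ℕ {k} (𝕍.⟦⟧-injective (inj₁-injective (encodeV-injective (trans (sym (a-even k)) eq)))) =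
    q , trans (ℕₚ.*-assoc q m 2) (cong (q *_) (trans (ℕₚ.*-comm m 2) (cong (λ k → m + k) (ℕₚ.+-identityʳ m))))
  ... | k , inj₂ refl with () ← encodeV-injective (trans (sym (a-odd k)) eq)

  order-b : ∀ n → iter F[ b ] n f₀ ≡ f₀ → ∃ λ k → n ≡ k * N
  order-b n eq = 𝔽.multiple-ℕ (𝔽.⟦⟧-injective (trans (sym (b-iter n)) eq))

  σ₂-power-v₀ : ∀ z → V[ ev (powℤ σ₂ z) ] v₀ ≡ v₀
  σ₂-power-v₀ (+ n)    = pow₂-v₀ n
  σ₂-power-v₀ -[1+ n ] = trans (pow-V incidence a b (inv σ₂) (suc n) v₀) (iter-fixed V[ b⁻¹ ] (b⁻¹-encode _) (suc n))

  σ₂-power-f₀ : ∀ z → F[ ev (powℤ σ₂ z) ] f₀ ≡ ⟦ z ⟧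
  σ₂-power-f₀ (+ n)    = trans (pow₂-f₀ n) (b-iter n)
  σ₂-power-f₀ -[1+ n ] = trans (pow-F incidence a b (inv σ₂) (suc n) f₀) (b⁻¹-iter (suc n))

  j₁ j₂ : ℤ
  j₁ = + 1 +ℤ + 2 *ℤ u
  j₂ = - (+ 1) +ℤ + 2 *ℤ u

  relation₁ : AgreeAtBase (powℕ σ₁ (m + m)) ε
  relation₁ =
    trans (pow₁-v₀ (m + m)) (trans (cong (λ n → iter V[ a ] n v₀) (trans (cong (λ k → m + k) (sym (ℕₚ.+-identityʳ m))) (ℕₚ.*-comm 2 m)))
      (trans (a-even m) (cong (λ k → encodeV (inj₁ k)) 𝕍.⟦n⟧))) ,
    trans (pow-F incidence a b σ₁ (m + m) f₀) (iter-fixed Θ Θ-f₀ (m + m))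

  relation₂ : AgreeAtBase (powℕ σ₂ N) ε
  relation₂ = pow₂-v₀ N , trans (pow₂-f₀ N) (trans (b-iter N) 𝔽.⟦n⟧)

  relation₃ : AgreeAtBase (powℕ (σ₁ · σ₂) 2) ε
  relation₃ = vertices , faces
    where
    open ≡-Reasoning
    vertices : V[ a ] (V[ b ] (V[ a ] (V[ b ] v₀))) ≡ v₀
    vertices = begin
      V[ a ] (V[ b ] (V[ a ] (V[ b ] v₀)))
        ≡⟨ cong (λ v → V[ a ] (V[ b ] v)) (trans (cong V[ a ] (b-encode _)) (a-encode _)) ⟩
      V[ a ] (V[ b ] (encodeV (inj₂ (shiftₘ (+ 1) ⟦ + 0 ⟧ₘ))))
        ≡⟨ trans (cong V[ a ] (b-encode _)) (a-encode _) ⟩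
      encodeV (inj₁ (shiftₘ (- (+ 1)) (shiftₘ (+ 1) ⟦ + 0 ⟧ₘ)))
        ≡⟨ cong (λ k → encodeV (inj₁ k)) (shiftₘ-shiftₘ (+ 1) (- (+ 1)) ⟦ + 0 ⟧ₘ refl) ⟩
      v₀ ∎
    faces : Θ (shift (+ 1) (Θ (shift (+ 1) f₀))) ≡ f₀
    faces = begin
      Θ (shift (+ 1) (Θ (shift (+ 1) f₀)))  ≡⟨ cong (λ f → Θ (shift (+ 1) (Θ f))) (shift-⟦⟧ (+ 1) (+ 0)) ⟩
      Θ (shift (+ 1) (Θ ⟦ + 1 ⟧))           ≡⟨ cong (λ f → Θ (shift (+ 1) f)) (trans (Θ-⟦⟧ (+ 1)) (cong ⟦_⟧ θ-1)) ⟩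
      Θ (shift (+ 1) ⟦ - (+ 1) ⟧)           ≡⟨ cong Θ (shift-⟦⟧ (+ 1) (- (+ 1))) ⟩
      Θ f₀                                  ≡⟨ Θ-f₀ ⟩
      f₀                                    ∎

  relation₄ : AgreeAtBase (inv σ₂ · σ₁) (powℤ σ₁ (+ 3) · powℤ σ₂ j₁)
  relation₄ = vertices , faces
    where
    open ≡-Reasoning
    vertices : V[ b⁻¹ ] (V[ a ] v₀) ≡ V[ a ] (V[ a ] (V[ a ] (V[ ev (powℤ σ₂ j₁) ] v₀)))
    vertices = begin
      V[ b⁻¹ ] (V[ a ] v₀)
        ≡⟨ trans (cong V[ b⁻¹ ] (a-encode _)) (b⁻¹-encode _) ⟩
      encodeV (inj₂ (shiftₘ (+ 1) (shiftₘ (+ 1) ⟦ + 0 ⟧ₘ)))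
        ≡⟨ sym (trans (cong V[ a ] (trans (cong V[ a ] (a-encode _)) (a-encode _))) (a-encode _)) ⟩
      V[ a ] (V[ a ] (V[ a ] v₀))
        ≡⟨ cong (λ v → V[ a ] (V[ a ] (V[ a ] v))) (sym (σ₂-power-v₀ j₁)) ⟩
      V[ a ] (V[ a ] (V[ a ] (V[ ev (powℤ σ₂ j₁) ] v₀))) ∎
    faces : shift (- (+ 1)) (Θ f₀) ≡ Θ (Θ (Θ (F[ ev (powℤ σ₂ j₁) ] f₀)))
    faces = begin
      shift (- (+ 1)) (Θ f₀)    ≡⟨ trans (cong (shift (- (+ 1))) Θ-f₀) (shift-⟦⟧ (- (+ 1)) (+ 0)) ⟩
      ⟦ - (+ 1) ⟧               ≡⟨ sym (𝔽.⟦⟧-cong θ³[1+2u]) ⟩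
      ⟦ θ (θ (θ j₁)) ⟧          ≡⟨ sym (trans (cong Θ (trans (cong Θ (Θ-⟦⟧ j₁)) (Θ-⟦⟧ (θ j₁)))) (Θ-⟦⟧ (θ (θ j₁)))) ⟩
      Θ (Θ (Θ ⟦ j₁ ⟧))          ≡⟨ cong (λ f → Θ (Θ (Θ f))) (sym (σ₂-power-f₀ j₁)) ⟩
      Θ (Θ (Θ (F[ ev (powℤ σ₂ j₁) ] f₀))) ∎

  relation₅ : AgreeAtBase (σ₂ · inv σ₁) (powℤ σ₁ (- (+ 3)) · powℤ σ₂ j₂)
  relation₅ = vertices , faces
    where
    open ≡-Reasoning
    vertices : V[ b ] (V[ a⁻¹ ] v₀) ≡ V[ a⁻¹ ] (V[ a⁻¹ ] (V[ a⁻¹ ] (V[ ev (powℤ σ₂ j₂) ] v₀)))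
    vertices = begin
      V[ b ] (V[ a⁻¹ ] v₀)
        ≡⟨ trans (cong V[ b ] (a⁻¹-encode _)) (b-encode _) ⟩
      encodeV (inj₂ (shiftₘ (- (+ 1)) ⟦ + 0 ⟧ₘ))
        ≡⟨ sym (trans (cong V[ a⁻¹ ] (trans (cong V[ a⁻¹ ] (a⁻¹-encode _)) (a⁻¹-encode _))) (a⁻¹-encode _)) ⟩
      V[ a⁻¹ ] (V[ a⁻¹ ] (V[ a⁻¹ ] v₀))
        ≡⟨ cong (λ v → V[ a⁻¹ ] (V[ a⁻¹ ] (V[ a⁻¹ ] v))) (sym (σ₂-power-v₀ j₂)) ⟩
      V[ a⁻¹ ] (V[ a⁻¹ ] (V[ a⁻¹ ] (V[ ev (powℤ σ₂ j₂) ] v₀))) ∎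
    faces : shift (+ 1) (Θ⁻¹ f₀) ≡ Θ⁻¹ (Θ⁻¹ (Θ⁻¹ (F[ ev (powℤ σ₂ j₂) ] f₀)))
    faces = begin
      shift (+ 1) (Θ⁻¹ f₀)      ≡⟨ cong (shift (+ 1)) (trans (Θ⁻¹-⟦⟧ (+ 0)) (cong ⟦_⟧ θ⁻¹-0)) ⟩
      shift (+ 1) f₀            ≡⟨ shift-⟦⟧ (+ 1) (+ 0) ⟩
      ⟦ + 1 ⟧                   ≡⟨ sym (𝔽.⟦⟧-cong θ⁻³[-1+2u]) ⟩
      ⟦ θ⁻¹ (θ⁻¹ (θ⁻¹ j₂)) ⟧    ≡⟨ sym (trans (cong Θ⁻¹ (trans (cong Θ⁻¹ (Θ⁻¹-⟦⟧ j₂)) (Θ⁻¹-⟦⟧ (θ⁻¹ j₂)))) (Θ⁻¹-⟦⟧ (θ⁻¹ (θ⁻¹ j₂)))) ⟩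
      Θ⁻¹ (Θ⁻¹ (Θ⁻¹ ⟦ j₂ ⟧))    ≡⟨ cong (λ f → Θ⁻¹ (Θ⁻¹ (Θ⁻¹ f))) (sym (σ₂-power-f₀ j₂)) ⟩
      Θ⁻¹ (Θ⁻¹ (Θ⁻¹ (F[ ev (powℤ σ₂ j₂) ] f₀))) ∎

  isAutGroupOfTightChiral : IsAutGroupOfTightChiral (m + m) N (+ 3) j₁ (- (+ 3)) j₂
  isAutGroupOfTightChiral =
    incidence , isPolyhedron , FlatMap.edge-degrees flatMap , FlatMap.tight flatMap , isChiral ,
    isAutGroup j₁ (- (+ 3)) j₂ order-a order-b relation₁ relation₂ relation₃ relation₄ relation₅

-- Powers of two.

-- To be read with μ = 2^(α-3) and U = 2^(β-3). The factor `l` records β ≥ α+1 and the factor `ν`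
-- records β ≥ 5; the sign `s` treats both groups at once.
conditions : ∀ μ l ν U .{{_ : NonZero U}} s → U ≡ 2 * μ * l → U ≡ 4 * ν → s ≡ + 1 ⊎ s ≡ - (+ 1) →
  Conditions (4 * μ) (8 * U) (s *ℤ + U)
conditions μ l ν U s U≡2μl U≡4ν s≡±1 = record
  { N∣8u  = s , trans (identity₁ s (+ U)) (cong (s *ℤ_) (sym (ℤₚ.pos-* 8 U)))
  ; N∣2u² = s *ℤ s *ℤ + ν , (begin
      + 2 *ℤ (s *ℤ + U *ℤ (s *ℤ + U))           ≡⟨ cong (λ x → + 2 *ℤ (s *ℤ + U *ℤ (s *ℤ x))) U₄ ⟩
      + 2 *ℤ (s *ℤ + U *ℤ (s *ℤ (+ 4 *ℤ + ν)))  ≡⟨ identity₂ s (+ U) (+ ν) ⟩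
      s *ℤ s *ℤ + ν *ℤ (+ 8 *ℤ + U)             ≡⟨ cong (s *ℤ s *ℤ + ν *ℤ_) (sym (ℤₚ.pos-* 8 U)) ⟩
      s *ℤ s *ℤ + ν *ℤ + (8 * U)                ∎)
  ; N∣u³  = s *ℤ s *ℤ s *ℤ (+ 2 *ℤ (+ ν *ℤ + ν)) , (begin
      s *ℤ + U *ℤ (s *ℤ + U) *ℤ (s *ℤ + U)                            ≡⟨ cong (λ x → s *ℤ + U *ℤ (s *ℤ x) *ℤ (s *ℤ x)) U₄ ⟩
      s *ℤ + U *ℤ (s *ℤ (+ 4 *ℤ + ν)) *ℤ (s *ℤ (+ 4 *ℤ + ν))          ≡⟨ identity₃ s (+ U) (+ ν) ⟩
      s *ℤ s *ℤ s *ℤ (+ 2 *ℤ (+ ν *ℤ + ν)) *ℤ (+ 8 *ℤ + U)            ≡⟨ cong (s *ℤ s *ℤ s *ℤ (+ 2 *ℤ (+ ν *ℤ + ν)) *ℤ_) (sym (ℤₚ.pos-* 8 U)) ⟩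
      s *ℤ s *ℤ s *ℤ (+ 2 *ℤ (+ ν *ℤ + ν)) *ℤ + (8 * U)               ∎)
  ; N∤4u  = λ q eq → s-odd q s≡±1 (ℤₚ.*-cancelˡ-≡ (+ 4 *ℤ + U) s (+ 2 *ℤ q)
      (trans (identity₄ s (+ U)) (trans eq (trans (cong (q *ℤ_) (ℤₚ.pos-* 8 U)) (identity₅ q (+ U))))))
  ; m∣2u  = s *ℤ + l , (begin
      + 2 *ℤ (s *ℤ + U)                         ≡⟨ cong (λ x → + 2 *ℤ (s *ℤ x)) U₂ ⟩
      + 2 *ℤ (s *ℤ (+ 2 *ℤ + μ *ℤ + l))         ≡⟨ identity₆ s (+ μ) (+ l) ⟩
      s *ℤ + l *ℤ (+ 4 *ℤ + μ)                  ≡⟨ cong (s *ℤ + l *ℤ_) (sym (ℤₚ.pos-* 4 μ)) ⟩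
      s *ℤ + l *ℤ + (4 * μ)                     ∎)
  ; m∣N   = + 4 *ℤ + l , (begin
      + (8 * U)                                 ≡⟨ ℤₚ.pos-* 8 U ⟩
      + 8 *ℤ + U                                ≡⟨ cong (+ 8 *ℤ_) U₂ ⟩
      + 8 *ℤ (+ 2 *ℤ + μ *ℤ + l)                ≡⟨ identity₇ (+ μ) (+ l) ⟩
      + 4 *ℤ + l *ℤ (+ 4 *ℤ + μ)                ≡⟨ cong (+ 4 *ℤ + l *ℤ_) (sym (ℤₚ.pos-* 4 μ)) ⟩
      + 4 *ℤ + l *ℤ + (4 * μ)                   ∎)
  ; 4∣m   = + μ , trans (ℤₚ.pos-* 4 μ) (ℤₚ.*-comm (+ 4) (+ μ)) }
  where
  open ≡-Reasoning
  U₄ : + U ≡ + 4 *ℤ + ν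
  U₄ = trans (cong +_ U≡4ν) (ℤₚ.pos-* 4 ν)
  U₂ : + U ≡ + 2 *ℤ + μ *ℤ + l
  U₂ = trans (cong +_ U≡2μl) (trans (ℤₚ.pos-* (2 * μ) l) (cong (_*ℤ + l) (ℤₚ.pos-* 2 μ)))
  instance
    4U≢0 : NonZeroℤ (+ 4 *ℤ + U)
    4U≢0 = ℤₚ.i*j≢0 (+ 4) (+ U)
  s-odd : ∀ q → s ≡ + 1 ⊎ s ≡ - (+ 1) → s ≢ + 2 *ℤ q
  s-odd q (inj₁ refl) eq = one-odd q eq
  s-odd q (inj₂ refl) eq = one-odd (- q) (trans (cong -_ eq) (ℤₚ.neg-distribʳ-* (+ 2) q))
  identity₁ : ∀ s U → + 8 *ℤ (s *ℤ U) ≡ s *ℤ (+ 8 *ℤ U)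
  identity₁ = solve-∀
  identity₂ : ∀ s U ν → + 2 *ℤ (s *ℤ U *ℤ (s *ℤ (+ 4 *ℤ ν))) ≡ s *ℤ s *ℤ ν *ℤ (+ 8 *ℤ U)
  identity₂ = solve-∀
  identity₃ : ∀ s U ν → s *ℤ U *ℤ (s *ℤ (+ 4 *ℤ ν)) *ℤ (s *ℤ (+ 4 *ℤ ν)) ≡ s *ℤ s *ℤ s *ℤ (+ 2 *ℤ (ν *ℤ ν)) *ℤ (+ 8 *ℤ U)
  identity₃ = solve-∀
  identity₄ : ∀ s U → + 4 *ℤ U *ℤ s ≡ + 4 *ℤ (s *ℤ U)
  identity₄ = solve-∀
  identity₅ : ∀ q U → q *ℤ (+ 8 *ℤ U) ≡ + 4 *ℤ U *ℤ (+ 2 *ℤ q)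
  identity₅ = solve-∀
  identity₆ : ∀ s μ l → + 2 *ℤ (s *ℤ (+ 2 *ℤ μ *ℤ l)) ≡ s *ℤ l *ℤ (+ 4 *ℤ μ)
  identity₆ = solve-∀
  identity₇ : ∀ μ l → + 8 *ℤ (+ 2 *ℤ μ *ℤ l) ≡ + 4 *ℤ l *ℤ (+ 4 *ℤ μ)
  identity₇ = solve-∀

-- With α = 3+x and β = 5+c the exponents involve no truncated subtraction, and α+1 ≤ β becomes
-- `x + 1 ≤ 2 + c`, whose gap `d` supplies the factor `2 ^ d` needed for `l`.
polyhedra : ∀ x c s → s ≡ + 1 ⊎ s ≡ - (+ 1) → x + 1 ≤ 2 + c →
  IsAutGroupOfTightChiral (2 ^ (3 + x)) (2 ^ (5 + c))
    (+ 3) (+ 1 +ℤ s *ℤ + (2 ^ (3 + c))) (- (+ 3)) (- (+ 1) +ℤ s *ℤ + (2 ^ (3 + c)))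
polyhedra x c s s≡±1 x+1≤2+c with d , eq ← ℕₚ.m≤n⇒∃[o]m+o≡n x+1≤2+c =
  transport p≡ q≡ (cong (+ 1 +ℤ_) t≡) (cong (- (+ 1) +ℤ_) t≡)
    (Construction.isAutGroupOfTightChiral (4 * μ) (8 * U) (s *ℤ + U)
      (conditions μ (2 ^ d) (2 ^ c) U s U≡2μl U≡4ν s≡±1))
  where
  μ U : ℕ
  μ = 2 ^ x
  U = 2 ^ (2 + c)
  instance
    μ≢0 : NonZero μ
    μ≢0 = ℕₚ.m^n≢0 2 x
    U≢0 : NonZero U
    U≢0 = ℕₚ.m^n≢0 2 (2 + c)
    4μ≢0 : NonZero (4 * μ)
    4μ≢0 = ℕₚ.m*n≢0 4 μ
    8U≢0 : NonZero (8 * U)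
    8U≢0 = ℕₚ.m*n≢0 8 U
  U≡2μl : U ≡ 2 * μ * 2 ^ d
  U≡2μl = trans (cong (2 ^_) (trans (sym eq) (cong (_+ d) (ℕₚ.+-comm x 1)))) (ℕₚ.^-distribˡ-+-* 2 (suc x) d)
  U≡4ν : U ≡ 4 * 2 ^ c
  U≡4ν = ℕₚ.^-distribˡ-+-* 2 2 c
  p≡ : 4 * μ + 4 * μ ≡ 2 ^ (3 + x)
  p≡ = trans (cong (λ k → 4 * μ + k) (sym (ℕₚ.+-identityʳ (4 * μ)))) (cong (2 *_) (ℕₚ.*-assoc 2 2 μ))
  q≡ : 8 * U ≡ 2 ^ (5 + c)
  q≡ = sym (ℕₚ.^-distribˡ-+-* 2 3 (2 + c))
  t≡ : + 2 *ℤ (s *ℤ + U) ≡ s *ℤ + (2 ^ (3 + c))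
  t≡ = trans (identity s (+ U)) (cong (s *ℤ_) (sym (ℤₚ.pos-* 2 U)))
    where
    identity : ∀ s U → + 2 *ℤ (s *ℤ U) ≡ s *ℤ (+ 2 *ℤ U)
    identity = solve-∀
  transport : ∀ {p p′ q q′ j j′ k k′} → p ≡ p′ → q ≡ q′ → j ≡ j′ → k ≡ k′ →
    IsAutGroupOfTightChiral p q (+ 3) j (- (+ 3)) k → IsAutGroupOfTightChiral p′ q′ (+ 3) j′ (- (+ 3)) k′
  transport refl refl refl refl result = result

theorem3p10 : (α β : ℕ) → 3 ≤ α → 5 ≤ β → α + 1 ≤ β →
    IsAutGroupOfTightChiral (2 ^ α) (2 ^ β)
    (+ 3) (+ 1 +ℤ + (2 ^ (β ∸ 2))) (- (+ 3)) (- (+ 1) +ℤ + (2 ^ (β ∸ 2)))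
    × IsAutGroupOfTightChiral (2 ^ α) (2 ^ β)
    (+ 3) (+ 1 -ℤ + (2 ^ (β ∸ 2))) (- (+ 3)) (- (+ 1) -ℤ + (2 ^ (β ∸ 2)))
theorem3p10 (suc (suc (suc x))) (suc (suc (suc (suc (suc c))))) (s≤s (s≤s (s≤s z≤n))) (s≤s (s≤s (s≤s (s≤s (s≤s z≤n))))) (s≤s (s≤s (s≤s x+1≤2+c))) =
  subst (λ t → IsAutGroupOfTightChiral (2 ^ (3 + x)) (2 ^ (5 + c)) (+ 3) (+ 1 +ℤ t) (- (+ 3)) (- (+ 1) +ℤ t))
    (ℤₚ.*-identityˡ (+ (2 ^ (3 + c)))) (polyhedra x c (+ 1) (inj₁ refl) x+1≤2+c) ,
  -- Integer subtraction unfolds to addition of the negative, so the sign -1 gives the second group.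
  subst (λ t → IsAutGroupOfTightChiral (2 ^ (3 + x)) (2 ^ (5 + c)) (+ 3) (+ 1 +ℤ t) (- (+ 3)) (- (+ 1) +ℤ t))
    (ℤₚ.-1*i≡-i (+ (2 ^ (3 + c)))) (polyhedra x c (- (+ 1)) (inj₂ refl) x+1≤2+c)
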